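{- There exists $d_0$ such that for all integers $d\geq d_0$ we have $f(d)\leq 2d-\log^* d$. Equivalently: for every $d\ge d_0$, every finite set $X$ and every family $\mathcal{F}$ of subsets of $X$ in which every element $x\in X$ is contained in at most $d$ sets of $\mathcal{F}$, there is a function $\chi\colon X\to\{ -1,+1\}$ such that $\bigl|\sum_{x\in S}\chi(x)\bigr|\leq 2d-\log^* d$ for every $S\in\mathcal{F}$.
   Context: For a finite set $X$ and a family $\mathcal{F}$ of subsets of $X$, a two-coloring is a function $\chi\colon X\to\{ -1,+1\}$, and $\chi(S)=\sum_{x\in S}\chi(x)$. The discrepancy of $\chi$ is $\max_{S\in\mathcal{F}}|\chi(S)|$, and $\operatorname{disc}\mathcal{F}$ is the minimum discrepancy over all two-colorings. The degree of $x\in X$ is the number of sets of $\mathcal{F}$ containing $x$. $f(d)$ denotes the maximum of $\operatorname{disc}\mathcal{F}$ over all finite set systems $(X,\mathcal{F})$ in which every element has degree at most $d$. Logarithms are base $2$; $\log^{(1)}x=\log x$, $\log^{(t+1)}x=\log^{(t)}\log x$, and $\log^* x=\min\{t:\log^{(t)}x\leq 1\}$. -}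

module Defs where

open import Data.Nat using (ℕ; zero; suc; _≤_; _<_)
open import Data.Nat.Logarithm using (⌈log₂_⌉)
open import Data.Integer using (ℤ; +_; -[1+_]; _+_; _-_; _*_; ∣_∣)
open import Data.Fin using (Fin)
open import Data.Fin.Subset using (Subset; _∈_)
open import Data.Vec using (Vec; lookup; zipWith; foldr; toList)
open import Data.Bool using (Bool; true; false; if_then_else_)
open import Data.List using (List; length; filter)
open import Data.List.Relation.Unary.Unique.Propositional using (Unique)
open import Data.Fin.Subset.Properties using (_∈?_)
open import Data.Product using (Σ; _×_)

-- iterated (ceiling) binary logarithm: iterLog t d = ⌈log₂⌉ applied t times.
-- For real x ≥ 1, ⌈log₂ x⌉ = ⌈log₂ ⌈x⌉⌉, and (log^(t) d ≤ 1 ⇔ ⌈log^(t) d⌉ ≤ 1),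
-- so the least t with iterLog t d ≤ 1 is exactly log* d.
iterLog : ℕ → ℕ → ℕ
iterLog zero    d = d
iterLog (suc t) d = ⌈log₂ iterLog t d ⌉

IsLogStar : ℕ → ℕ → Set
IsLogStar d t = (iterLog t d ≤ 1) × (∀ s → s < t → 1 < iterLog s d)

Coloring : ℕ → Set
Coloring n = Fin n → Bool

sign : Bool → ℤ
sign true  = + 1
sign false = -[1+ 0 ]

χsum : ∀ {n} → Coloring n → Subset n → ℤ
χsum {n} χ S = go S (Data.Vec.tabulate (λ i → i))
  where
    go : ∀ {m} → Vec Data.Fin.Subset.Side m → Vec (Fin n) m → ℤ
    go Vec.[] Vec.[] = + 0
    go (Data.Fin.Subset.inside Vec.∷ s) (i Vec.∷ is) = sign (χ i) + go s is
    go (Data.Fin.Subset.outside Vec.∷ s) (i Vec.∷ is) = go s is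

-- degree of x in the family 𝓕 (a duplicate-free list of subsets)
degree : ∀ {n} → List (Subset n) → Fin n → ℕ
degree 𝓕 x = length (filter (x ∈?_) 𝓕)

MaxDegree≤ : ∀ {n} → List (Subset n) → ℕ → Set
MaxDegree≤ {n} 𝓕 d = (x : Fin n) → degree 𝓕 x ≤ d

{-# OPTIONS --safe #-}
module Submission where

-- As in the Beck–Fiala argument, all colours start at 0 and move inside [-1, 1] along solutions of linear equations
-- until they freeze at ±1. A set is settled once no completion of the current colouring takes its sum beyond 2d − k.
-- If there are fewer unsettled sets than floating elements, one moves while keeping all their sums. Otherwise double
-- counting shows that unsettled sets and floating elements form an almost d-regular incidence structure. An unsettled
-- set with sum 0 and at most d + 10k floating elements has almost all of these near the same end, so that its sum can
-- fall by at most 21k towards that end, and a few elements freezing there settle it. The sums of such sets need not be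
-- kept one by one: every such set is linked to 4200k of its elements, each of these centres being shared by at least
-- 46200k sets, and only the total sum over each star is kept, together with the sums of the sets which are too big,
-- not yet fully linked, or already off by 420k. A star whose centre floats loses a set only when the degree of the
-- centre drops below d, so the missing degrees, which are few, bound how far the sets of the stars drift on average.
-- Hence the kept sums number fewer than the floating elements and the colouring can always move on. All this works
-- as soon as 466201 k ≤ d, which holds for k = log* d when d ≥ 2³⁰.

open import Defs
open import Algebra.Properties.Semiring.Sum as Sums using ()
open import Data.Bool using (Bool; true; false; not; _∧_; _∨_)
import Data.Bool.Properties as Bool
open import Data.Empty using (⊥-elim)
open import Data.Fin using (Fin; zero; suc)
import Data.Fin.Properties as Fin
open import Data.Fin.Subset using (Subset)
import Data.Fin.Subset as Subset
open import Data.Fin.Subset.Properties using (_∈?_)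
open import Data.Integer hiding (suc; sign; _≥_)
open import Data.Integer.Properties
open import Data.Integer.Tactic.RingSolver using (solve-∀)
open import Data.List using (List; []; _∷_; _++_; length; map; filter; allFin)
import Data.List as List
open import Data.List.Membership.Propositional using (_∈_)
open import Data.List.Membership.Propositional.Properties using (∈-allFin; ∈-filter⁺; ∈-map⁺; ∈-++⁺ˡ; ∈-++⁺ʳ)
open import Data.List.Properties using (length-map; length-++; length-++-comm; filter-accept; filter-reject)
open import Data.List.Relation.Unary.All using (All; []; _∷_)
import Data.List.Relation.Unary.All as All
import Data.List.Relation.Unary.All.Properties as All
open import Data.List.Relation.Unary.Any using (index)
open import Data.List.Relation.Unary.Any.Properties using (lookup-index)
open import Data.List.Relation.Unary.Unique.Propositional using (Unique)
open import Data.Nat using (ℕ; _≥_)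
import Data.Nat as ℕ
open import Data.Nat.Logarithm using (⌈log₂_⌉; ⌈log₂⌉-mono-≤; ⌈log₂2^n⌉≡n)
import Data.Nat.Properties as ℕ
open import Data.Product using (∃; ∃-syntax; _×_; _,_; proj₁; proj₂)
open import Data.Sum using (_⊎_; inj₁; inj₂; [_,_]′)
open import Data.Vec using (Vec; []; _∷_; lookup; tabulate)
open import Data.Vec.Properties using ([]=⇒lookup; lookup⇒[]=; lookup∘tabulate)
open import Function using (_∘_)
open import Relation.Binary.PropositionalEquality using (_≡_; _≢_; refl; sym; trans; cong; cong₂; subst; subst₂; module ≡-Reasoning)
open import Relation.Nullary using (¬_; Dec; yes; no; does)
open import Relation.Nullary.Decidable using (_×-dec_)

-- Integer inequalities and finite sums

infixl 6 _⊕_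
infixl 7 _⊗_

-- Nonnegativity proofs combine with the precedences of `+` and `*`, so a certificate has the shape
-- of the polynomial it certifies.
_⊕_ : ∀ {x y} → 0ℤ ≤ x → 0ℤ ≤ y → 0ℤ ≤ x + y
_⊕_ = +-mono-≤

_⊗_ : ∀ {x y} → 0ℤ ≤ x → 0ℤ ≤ y → 0ℤ ≤ x * y
_⊗_ {x} 0≤x 0≤y = ≤-trans (≤-reflexive (sym (*-zeroʳ x))) (*-monoˡ-≤-nonNeg x {{nonNegative 0≤x}} 0≤y)

gap : ∀ {x y} → x ≤ y → 0ℤ ≤ y - x
gap = i≤j⇒0≤j-i

gap< : ∀ {x y} → x < y → 0ℤ ≤ y - x - 1ℤ
gap< {x} {y} x<y = subst (0ℤ ≤_) (ring x y) (gap (i<j⇒suc[i]≤j x<y))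
  where
  ring : ∀ x y → y - (1ℤ + x) ≡ y - x - 1ℤ
  ring = solve-∀

-- Inequalities are proved by writing the difference of the two sides as a visibly nonnegative expression.
by : ∀ {x y z} → 0ℤ ≤ z → z ≡ y - x → x ≤ y
by 0≤z refl = 0≤i-j⇒j≤i 0≤z

by< : ∀ {x y z} → 0ℤ ≤ z → z ≡ y - x - 1ℤ → x < y
by< {x} {y} 0≤z refl = suc[i]≤j⇒i<j (by 0≤z (ring x y))
  where
  ring : ∀ x y → y - x - 1ℤ ≡ y - (1ℤ + x)
  ring = solve-∀

cancel-pos : ∀ {x y z} → 0ℤ < z → z * x ≤ z * y → x ≤ y
cancel-pos {x} {y} {z} 0<z = *-cancelˡ-≤-pos x y z {{positive 0<z}}

*≢0 : ∀ {x y} → x ≢ 0ℤ → y ≢ 0ℤ → x * y ≢ 0ℤ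
*≢0 {x} x≢0 y≢0 xy≡0 = [ x≢0 , y≢0 ]′ (i*j≡0⇒i≡0∨j≡0 x xy≡0)

false≢true : false ≢ true
false≢true ()

ι : Bool → ℤ
ι true  = 1ℤ
ι false = 0ℤ

0≤ι : ∀ b → 0ℤ ≤ ι b
0≤ι true  = +≤+ ℕ.z≤n
0≤ι false = ≤-refl

abstract
  -- Opaque, so that outside this block sums are rewritten only by the laws below and never unfold
  -- into nested additions.
  ∑ : ∀ {n} → (Fin n → ℤ) → ℤ
  ∑ = Sums.sum +-*-semiring

  ∑-suc : ∀ {n} (f : Fin (ℕ.suc n) → ℤ) → ∑ f ≡ f zero + ∑ (f ∘ suc)
  ∑-suc f = refl

  ∑-cong : ∀ {n} {f g : Fin n → ℤ} → (∀ i → f i ≡ g i) → ∑ f ≡ ∑ g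
  ∑-cong = Sums.sum-cong-≗ +-*-semiring

  ∑-+ : ∀ {n} (f g : Fin n → ℤ) → ∑ (λ i → f i + g i) ≡ ∑ f + ∑ g
  ∑-+ = Sums.∑-distrib-+ +-*-semiring

  ∑-* : ∀ {n} x (f : Fin n → ℤ) → ∑ (λ i → x * f i) ≡ x * ∑ f
  ∑-* x f = sym (Sums.*-distribˡ-sum +-*-semiring x f)

  ∑-swap : ∀ {m n} (f : Fin m → Fin n → ℤ) → ∑ (λ i → ∑ (f i)) ≡ ∑ (λ j → ∑ (λ i → f i j))
  ∑-swap = Sums.∑-comm +-*-semiring

  ∑-mono : ∀ {n} {f g : Fin n → ℤ} → (∀ i → f i ≤ g i) → ∑ f ≤ ∑ g
  ∑-mono {ℕ.zero}  f≤g = ≤-refl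
  ∑-mono {ℕ.suc n} f≤g = +-mono-≤ (f≤g zero) (∑-mono (f≤g ∘ suc))

  ∑-zero : ∀ {n} {f : Fin n → ℤ} → (∀ i → f i ≡ 0ℤ) → ∑ f ≡ 0ℤ
  ∑-zero {ℕ.zero}  f≡0 = refl
  ∑-zero {ℕ.suc n} f≡0 = cong₂ _+_ (f≡0 zero) (∑-zero (f≡0 ∘ suc))

  ∑-strict : ∀ {n} {f g : Fin n → ℤ} → (∀ i → f i ≤ g i) → ∀ i → f i < g i → ∑ f < ∑ g
  ∑-strict f≤g zero    lt = +-mono-<-≤ lt (∑-mono (f≤g ∘ suc))
  ∑-strict f≤g (suc i) lt = +-mono-≤-< (f≤g zero) (∑-strict (f≤g ∘ suc) i lt)

∑-nonneg : ∀ {n} {f : Fin n → ℤ} → (∀ i → 0ℤ ≤ f i) → 0ℤ ≤ ∑ f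
∑-nonneg {n} 0≤f = ≤-trans (≤-reflexive (sym (∑-zero {n} (λ _ → refl)))) (∑-mono 0≤f)

∑-member : ∀ {n} {f : Fin n → ℤ} → (∀ i → 0ℤ ≤ f i) → ∀ i → f i ≤ ∑ f
∑-member {f = f} 0≤f zero = ≤-trans (≤-reflexive (sym (+-identityʳ (f zero))))
  (≤-trans (+-monoʳ-≤ (f zero) (∑-nonneg (0≤f ∘ suc))) (≤-reflexive (sym (∑-suc f))))
∑-member {f = f} 0≤f (suc i) = ≤-trans (∑-member (0≤f ∘ suc) i) (≤-trans (≤-reflexive (sym (+-identityˡ _)))
  (≤-trans (+-monoˡ-≤ _ (0≤f zero)) (≤-reflexive (sym (∑-suc f)))))

∑-linear : ∀ {n} x y (f g : Fin n → ℤ) → ∑ (λ i → x * f i + y * g i) ≡ x * ∑ f + y * ∑ g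
∑-linear x y f g = trans (∑-+ (λ i → x * f i) (λ i → y * g i)) (cong₂ _+_ (∑-* x f) (∑-* y g))

∑-minus : ∀ {n} (f g : Fin n → ℤ) → ∑ (λ i → f i - g i) ≡ ∑ f - ∑ g
∑-minus f g = trans (∑-cong λ i → ring (f i) (g i)) (trans (∑-linear 1ℤ -1ℤ f g) (sym (ring (∑ f) (∑ g))))
  where
  ring : ∀ x y → x - y ≡ 1ℤ * x + -1ℤ * y
  ring = solve-∀

length-filter-allFin : ∀ {n} (b : Fin n → Bool) → + length (filter (λ i → b i Bool.≟ true) (allFin n)) ≡ ∑ (ι ∘ b)
length-filter-allFin {n} b = go n (λ i → i)
  where
  go : ∀ r (f : Fin r → Fin n) → + length (filter (λ i → b i Bool.≟ true) (List.tabulate f)) ≡ ∑ (λ i → ι (b (f i)))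
  go ℕ.zero    f = sym (∑-zero λ ())
  go (ℕ.suc r) f = trans (head (b (f zero)) refl) (sym (∑-suc (λ i → ι (b (f i)))))
    where
    head : ∀ c → b (f zero) ≡ c →
      + length (filter (λ i → b i Bool.≟ true) (List.tabulate f)) ≡ ι (b (f zero)) + ∑ (λ i → ι (b (f (suc i))))
    head true  eq rewrite eq = cong (_+_ 1ℤ) (go r (f ∘ suc))
    head false eq rewrite eq = trans (go r (f ∘ suc)) (sym (+-identityˡ _))

-- Integer solutions of homogeneous linear systems

cons : ∀ {n} → ℤ → (Fin n → ℤ) → Fin (ℕ.suc n) → ℤ
cons x v zero    = x
cons x v (suc i) = v i

_·_ : ∀ {n} → (Fin n → ℤ) → (Fin n → ℤ) → ℤ
ρ · y = ∑ λ i → ρ i * y i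

pivot : ∀ {n} (rows : List (Fin (ℕ.suc n) → ℤ)) →
  All (λ ρ → ρ zero ≡ 0ℤ) rows ⊎ (∃[ xs ] ∃[ ρ ] ∃[ ys ] (rows ≡ xs ++ ρ ∷ ys × ρ zero ≢ 0ℤ))
pivot []         = inj₁ []
pivot (ρ ∷ rows) with ρ zero ≟ 0ℤ
... | no  ρ≢0 = inj₂ ([] , ρ , rows , refl , ρ≢0)
... | yes ρ≡0 with pivot rows
...   | inj₁ all0 = inj₁ (ρ≡0 ∷ all0)
...   | inj₂ (xs , σ , ys , refl , σ≢0) = inj₂ (ρ ∷ xs , σ , ys , refl , σ≢0)

-- Gaussian elimination without division.
kernel-vector : ∀ {n} (F : Fin n → Bool) (rows : List (Fin n → ℤ)) → + length rows < ∑ (ι ∘ F) →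
  ∃[ y ] ((∃[ i ] y i ≢ 0ℤ) × (∀ i → F i ≡ false → y i ≡ 0ℤ) × All (λ ρ → ρ · y ≡ 0ℤ) rows)
kernel-vector {ℕ.zero}  F rows few with +<+ () ← <-≤-trans few (≤-reflexive (∑-zero {f = ι ∘ F} λ ()))
kernel-vector {ℕ.suc n} F rows few with F zero in F₀ | subst (+ length rows <_) (∑-suc (ι ∘ F)) few
... | false | few₀ = extend (kernel-vector (F ∘ suc) (map (_∘ suc) rows) few′)
  where
  few′ : + length (map (_∘ suc) rows) < ∑ (ι ∘ F ∘ suc)
  few′ = subst₂ _<_ (cong +_ (sym (length-map (_∘ suc) rows))) (+-identityˡ _) few₀

  extend : ∃[ y ] ((∃[ i ] y i ≢ 0ℤ) × (∀ i → F (suc i) ≡ false → y i ≡ 0ℤ) × All (λ ρ → ρ · y ≡ 0ℤ) (map (_∘ suc) rows)) → _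
  extend (y , (i , yᵢ≢0) , off , sol) = cons 0ℤ y , (suc i , yᵢ≢0) , off′ , All.map (λ {ρ} → solves ρ) (All.map⁻ sol)
    where
    off′ : ∀ i → F i ≡ false → cons 0ℤ y i ≡ 0ℤ
    off′ zero    _  = refl
    off′ (suc i) eq = off i eq

    solves : ∀ ρ → (ρ ∘ suc) · y ≡ 0ℤ → ρ · cons 0ℤ y ≡ 0ℤ
    solves ρ eq = trans (∑-suc (λ i → ρ i * cons 0ℤ y i)) (cong₂ _+_ (*-zeroʳ (ρ zero)) eq)
... | true | few₀ with pivot rows
...   | inj₁ all0 = cons 1ℤ (λ _ → 0ℤ) , (zero , λ ()) , off , All.map (λ {ρ} → solves ρ) all0
  where
  off : ∀ i → F i ≡ false → cons 1ℤ (λ _ → 0ℤ) i ≡ 0ℤ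
  off zero    eq with () ← trans (sym F₀) eq
  off (suc i) _  = refl

  solves : ∀ ρ → ρ zero ≡ 0ℤ → ρ · cons 1ℤ (λ _ → 0ℤ) ≡ 0ℤ
  solves ρ ρ≡0 = trans (∑-suc (λ i → ρ i * cons 1ℤ (λ _ → 0ℤ) i))
    (cong₂ _+_ (trans (*-identityʳ (ρ zero)) ρ≡0) (∑-zero {n} λ i → *-zeroʳ (ρ (suc i))))
...   | inj₂ (xs , ρ , ys , refl , ρ≢0) = extend (kernel-vector (F ∘ suc) (map reduce (xs ++ ys)) few′)
  where
  reduce : (Fin (ℕ.suc n) → ℤ) → Fin n → ℤ
  reduce σ j = ρ zero * σ (suc j) + - σ zero * ρ (suc j)

  len : length (xs ++ ρ ∷ ys) ≡ ℕ.suc (length (map reduce (xs ++ ys)))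
  len = trans (length-++-comm xs (ρ ∷ ys)) (cong ℕ.suc (trans (length-++-comm ys xs) (sym (length-map reduce (xs ++ ys)))))

  few′ : + length (map reduce (xs ++ ys)) < ∑ (ι ∘ F ∘ suc)
  few′ = by< (gap< (subst (λ l → + l < 1ℤ + ∑ (ι ∘ F ∘ suc)) len few₀)) (ring (+ length (map reduce (xs ++ ys))) (∑ (ι ∘ F ∘ suc)))
    where
    ring : ∀ y z → 1ℤ + z - (1ℤ + y) - 1ℤ ≡ z - y - 1ℤ
    ring = solve-∀

  extend : ∃[ y ] ((∃[ i ] y i ≢ 0ℤ) × (∀ i → F (suc i) ≡ false → y i ≡ 0ℤ) × All (λ σ → σ · y ≡ 0ℤ) (map reduce (xs ++ ys))) → _
  extend (y , (i , yᵢ≢0) , off , sol) = z , (suc i , *≢0 ρ≢0 yᵢ≢0) , off′ ,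
    All.++⁺ (All.map (λ {σ} → solves σ) (All.++⁻ˡ xs sol′)) (pivot-row ∷ All.map (λ {σ} → solves σ) (All.++⁻ʳ xs sol′))
    where
    z : Fin (ℕ.suc n) → ℤ
    -- The first coordinate is what the pivot row forces once the others are scaled by its entry
    -- `ρ zero`. Nonzero coordinates stay nonzero under this scaling.
    z = cons (- ((ρ ∘ suc) · y)) (λ j → ρ zero * y j)

    sol′ : All (λ σ → reduce σ · y ≡ 0ℤ) (xs ++ ys)
    sol′ = All.map⁻ sol

    off′ : ∀ i → F i ≡ false → z i ≡ 0ℤ
    off′ zero    eq with () ← trans (sym F₀) eq
    off′ (suc i) eq = trans (cong (ρ zero *_) (off i eq)) (*-zeroʳ (ρ zero))

    dot-z : ∀ σ → σ · z ≡ σ zero * - ((ρ ∘ suc) · y) + ρ zero * ((σ ∘ suc) · y)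
    dot-z σ = trans (∑-suc (λ i → σ i * z i)) (cong (_+_ (σ zero * - ((ρ ∘ suc) · y)))
      (trans (∑-cong λ j → ring (σ (suc j)) (ρ zero) (y j)) (∑-* (ρ zero) (λ j → σ (suc j) * y j))))
      where
      ring : ∀ a b c → a * (b * c) ≡ b * (a * c)
      ring = solve-∀

    pivot-row : ρ · z ≡ 0ℤ
    pivot-row = trans (dot-z ρ) (ring (ρ zero) ((ρ ∘ suc) · y))
      where
      ring : ∀ a b → a * - b + a * b ≡ 0ℤ
      ring = solve-∀

    solves : ∀ σ → reduce σ · y ≡ 0ℤ → σ · z ≡ 0ℤ
    solves σ eq = begin
      σ · z                                                  ≡⟨ dot-z σ ⟩
      σ zero * - ((ρ ∘ suc) · y) + ρ zero * ((σ ∘ suc) · y)  ≡⟨ ring₁ (σ zero) (ρ zero) ((ρ ∘ suc) · y) ((σ ∘ suc) · y) ⟩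
      ρ zero * ((σ ∘ suc) · y) + - σ zero * ((ρ ∘ suc) · y)  ≡⟨ ∑-linear (ρ zero) (- σ zero) (λ j → σ (suc j) * y j) (λ j → ρ (suc j) * y j) ⟨
      ∑ (λ j → ρ zero * (σ (suc j) * y j) + - σ zero * (ρ (suc j) * y j))
        ≡⟨ ∑-cong (λ j → ring₂ (ρ zero) (σ zero) (σ (suc j)) (ρ (suc j)) (y j)) ⟨
      reduce σ · y                                           ≡⟨ eq ⟩
      0ℤ                                                     ∎
      where
      open ≡-Reasoning
      ring₁ : ∀ a b c e → a * - c + b * e ≡ b * e + - a * c
      ring₁ = solve-∀
      ring₂ : ∀ b a s r y → (b * s + - a * r) * y ≡ b * (s * y) + - a * (r * y)
      ring₂ = solve-∀

-- The first obstacle on a ray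

module _ {C : Set} (slack speed : C → ℤ) (0≤slack : ∀ c → 0ℤ ≤ slack c) where

  -- An obstacle is reached after time slack / speed. Cross-multiplied, the inequality says that `h`
  -- has the least such time; obstacles of nonpositive speed satisfy it automatically.
  FirstHit : List C → C → Set
  FirstHit cs h = 0ℤ < speed h × All (λ c → slack h * speed c ≤ slack c * speed h) cs

  unhurried : ∀ h c → 0ℤ < speed h → speed c ≤ 0ℤ → slack h * speed c ≤ slack c * speed h
  unhurried h c 0<h c≤0 = by ((0≤slack h ⊗ gap c≤0) ⊕ (0≤slack c ⊗ <⇒≤ 0<h)) (ring (slack h) (speed c) (slack c) (speed h))
    where
    ring : ∀ a b c e → a * (0ℤ - b) + c * e ≡ c * e - a * b
    ring = solve-∀

  first-hit : (cs : List C) → All (λ c → speed c ≤ 0ℤ) cs ⊎ ∃ (FirstHit cs)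
  first-hit [] = inj₁ []
  first-hit (c ∷ cs) with 0ℤ <? speed c | first-hit cs
  ... | no  c≯0 | inj₁ slow             = inj₁ (≮⇒≥ c≯0 ∷ slow)
  ... | no  c≯0 | inj₂ (h , 0<h , best) = inj₂ (h , 0<h , unhurried h c 0<h (≮⇒≥ c≯0) ∷ best)
  ... | yes 0<c | inj₁ slow             = inj₂ (c , 0<c , ≤-refl ∷ All.map (unhurried c _ 0<c) slow)
  ... | yes 0<c | inj₂ (h , 0<h , best) with slack h * speed c ≤? slack c * speed h
  ...   | yes h≤c = inj₂ (h , 0<h , h≤c ∷ best)
  ...   | no  h≰c = inj₂ (c , 0<c , ≤-refl ∷ All.map better best)
    where
    better : ∀ {e} → slack h * speed e ≤ slack e * speed h → slack c * speed e ≤ slack e * speed c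
    better {e} h≤e with 0ℤ <? speed e
    ... | no  e≯0 = unhurried c e 0<c (≮⇒≥ e≯0)
    ... | yes 0<e = cancel-pos 0<h (by
      ((gap (<⇒≤ (≰⇒> h≰c)) ⊗ <⇒≤ 0<e) ⊕ (gap h≤e ⊗ <⇒≤ 0<c))
      (ring (slack c) (speed c) (slack h) (speed h) (slack e) (speed e)))
      where
      ring : ∀ a b c e f g → (c * b - a * e) * g + (f * e - c * g) * b ≡ e * (f * b) - e * (a * g)
      ring = solve-∀

-- Frozen colours and unsettled sets

data Status : Set where
  top bot float : Status

data StatusView (D x : ℤ) : Status → Set where
  top   : x ≡ D → StatusView D x top
  bot   : x ≡ - D → StatusView D x bot
  float : x ≢ D → x ≢ - D → StatusView D x float

neg≢ : ∀ {D} → 0ℤ < D → - D ≢ D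
neg≢ {D} 0<D eq = <-irrefl eq (<-trans (neg-mono-< 0<D) 0<D)

abstract
  status : ℤ → ℤ → Status
  status D x with x ≟ D | x ≟ - D
  ... | yes _ | _     = top
  ... | no  _ | yes _ = bot
  ... | no  _ | no  _ = float

  status-view : ∀ D x → StatusView D x (status D x)
  status-view D x with x ≟ D | x ≟ - D
  ... | yes p | _     = top p
  ... | no  _ | yes p = bot p
  ... | no  p | no  q = float p q

  status-top : ∀ {D x} → x ≡ D → status D x ≡ top
  status-top {D} {x} x≡D with x ≟ D | x ≟ - D
  ... | yes _ | _ = refl
  ... | no x≢D | _ = ⊥-elim (x≢D x≡D)

  status-bot : ∀ {D x} → 0ℤ < D → x ≡ - D → status D x ≡ bot
  status-bot {D} {x} 0<D x≡-D with x ≟ D | x ≟ - D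
  ... | yes x≡D | _     = ⊥-elim (neg≢ 0<D (trans (sym x≡-D) x≡D))
  ... | no  _   | yes _ = refl
  ... | no  _   | no x≢-D = ⊥-elim (x≢-D x≡-D)

-- Contributions to the largest values of χ(S) and of -χ(S) among completions. The flipped sign in
-- `lo` lets both extremes be compared with the same threshold.
hi lo : Status → ℤ
hi top   = 1ℤ
hi bot   = -1ℤ
hi float = 1ℤ
lo top   = -1ℤ
lo bot   = 1ℤ
lo float = 1ℤ

isFloat : Status → Bool
isFloat top   = false
isFloat bot   = false
isFloat float = true

data Kind : Set where
  over under settled : Kind

data KindView (T u v : ℤ) : Kind → Set where
  over    : T < u → KindView T u v over
  under   : u ≤ T → T < v → KindView T u v under
  settled : u ≤ T → v ≤ T → KindView T u v settled

abstract
  -- The kind names a side on which the threshold `T` can still be exceeded, `over` taking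
  -- precedence if both sides qualify. For sets with at most `d + 10k` floating elements,
  -- `both-arith` excludes that case.
  kind : ℤ → ℤ → ℤ → Kind
  kind T u v with T <? u | T <? v
  ... | yes _ | _     = over
  ... | no  _ | yes _ = under
  ... | no  _ | no  _ = settled

  kind-view : ∀ T u v → KindView T u v (kind T u v)
  kind-view T u v with T <? u | T <? v
  ... | yes p | _     = over p
  ... | no  p | yes q = under (≮⇒≥ p) q
  ... | no  p | no  q = settled (≮⇒≥ p) (≮⇒≥ q)

unsettled : Kind → Bool
unsettled over    = true
unsettled under   = true
unsettled settled = false

orientation : Kind → ℤ
orientation over    = 1ℤ
orientation under   = -1ℤ
orientation settled = 0ℤ

unsettled-cases : ∀ {T u v κ} → KindView T u v κ → κ ≢ settled → (1ℤ ≡ orientation κ × T < u) ⊎ (-1ℤ ≡ orientation κ × T < v)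
unsettled-cases (over T<u)    _  = inj₁ (refl , T<u)
unsettled-cases (under _ T<v) _  = inj₂ (refl , T<v)
unsettled-cases (settled _ _) un = ⊥-elim (un refl)

deficit-arith : ∀ D d k w h f → 0ℤ ≤ D → D * h ≤ w + + 2 * D * f → + 2 * d - k < h → + 2 * D * (d - f) ≤ w + k * D
deficit-arith D d k w h f 0≤D hb T<h = by (gap hb ⊕ 0≤D ⊗ gap< T<h ⊕ 0≤D) (ring D d k w h f)
  where
  ring : ∀ D d k w h f → (w + + 2 * D * f - D * h) + D * (h - (+ 2 * d - k) - 1ℤ) + D ≡ w + k * D - + 2 * D * (d - f)
  ring = solve-∀

-- The two extremes add up to twice the number of floating elements, at most `2d + 20k`. If one
-- exceeds `2d − k`, at most `21k` remains for the other; this is the source of the constant 21.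
opposite-arith : ∀ d k h l f → h + l ≡ + 2 * f → f ≤ d + + 10 * k → (+ 2 * d - k) < h → l ≤ + 21 * k
opposite-arith d k h l f h+l small T<h = by (+≤+ (ℕ.z≤n {2}) ⊗ gap small ⊕ gap< T<h ⊕ +≤+ (ℕ.z≤n {1}))
  (trans (ring d k h f) (trans (cong (λ z → + 21 * k + h - z) (sym h+l)) (ring′ k h l)))
  where
  ring : ∀ d k h f → + 2 * (d + + 10 * k - f) + (h - (+ 2 * d - k) - 1ℤ) + 1ℤ ≡ + 21 * k + h - + 2 * f
  ring = solve-∀
  ring′ : ∀ k h l → + 21 * k + h - (h + l) ≡ + 21 * k - l
  ring′ = solve-∀

-- Set systems and fractional colourings

module System (m n : ℕ) (A : Fin m → Fin n → Bool) (d k : ℤ) where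

  weight : Fin m → (Fin n → ℤ) → ℤ
  weight S f = ∑ λ i → ι (A S i) * f i

  weight-mono : ∀ S {f g} → (∀ i → f i ≤ g i) → weight S f ≤ weight S g
  weight-mono S f≤g = ∑-mono λ i → *-monoˡ-≤-nonNeg (ι (A S i)) {{nonNegative (0≤ι (A S i))}} (f≤g i)

  weight-linear : ∀ S x y f g → weight S (λ i → x * f i + y * g i) ≡ x * weight S f + y * weight S g
  weight-linear S x y f g = trans (∑-cong λ i → ring (ι (A S i)) x y (f i) (g i)) (∑-linear x y _ _)
    where
    ring : ∀ a x y f g → a * (x * f + y * g) ≡ x * (a * f) + y * (a * g)
    ring = solve-∀

  weight-scale : ∀ S x f → weight S (λ i → x * f i) ≡ x * weight S f
  weight-scale S x f = trans (∑-cong λ i → ring (ι (A S i)) x (f i)) (∑-* x _)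
    where
    ring : ∀ a x f → a * (x * f) ≡ x * (a * f)
    ring = solve-∀

  weight-bound : ∀ S x y z f g h → (∀ i → x * f i ≤ y * g i + z * h i) → x * weight S f ≤ y * weight S g + z * weight S h
  weight-bound S x y z f g h le = subst₂ _≤_ (weight-scale S x f) (weight-linear S y z g h) (weight-mono S le)

  -- The colour of i is the rational number a i / D; a common denominator keeps everything in ℤ.
  module Colour (D : ℤ) (a : Fin n → ℤ) where

    st : Fin n → Status
    st i = status D (a i)

    floating : Fin n → Bool
    floating i = isFloat (st i)

    -- highest S and - lowest S are the extreme sums of S over all completions of the colouring.
    value highest lowest floats : Fin m → ℤ
    value   S = weight S a
    highest S = weight S (λ i → hi (st i))
    lowest  S = weight S (λ i → lo (st i))
    floats  S = weight S (λ i → ι (floating i))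

    kindOf : Fin m → Kind
    kindOf S = kind (+ 2 * d - k) (highest S) (lowest S)

    -- `signed` measures the sum towards the endangered side. In a small set it is at least `−21kD`,
    -- so adding `21kD` makes `mass` nonnegative.
    signed mass : Fin m → ℤ
    signed S = orientation (kindOf S) * value S
    mass   S = ι (unsettled (kindOf S)) * (+ 21 * k * D) + signed S

    highest+lowest : ∀ S → highest S + lowest S ≡ + 2 * floats S
    highest+lowest S = begin
      highest S + lowest S                              ≡⟨ ring (highest S) (lowest S) ⟩
      1ℤ * highest S + 1ℤ * lowest S                    ≡⟨ weight-linear S 1ℤ 1ℤ (λ i → hi (st i)) (λ i → lo (st i)) ⟨
      weight S (λ i → 1ℤ * hi (st i) + 1ℤ * lo (st i))  ≡⟨ ∑-cong (λ i → cong (ι (A S i) *_) (pointwise (st i))) ⟩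
      weight S (λ i → + 2 * ι (floating i))             ≡⟨ weight-scale S (+ 2) (λ i → ι (floating i)) ⟩
      + 2 * floats S                                    ∎
      where
      open ≡-Reasoning
      ring : ∀ x y → x + y ≡ 1ℤ * x + 1ℤ * y
      ring = solve-∀
      pointwise : ∀ s → 1ℤ * hi s + 1ℤ * lo s ≡ + 2 * ι (isFloat s)
      pointwise top   = refl
      pointwise bot   = refl
      pointwise float = refl

    Bounded : Set
    Bounded = ∀ i → - D ≤ a i × a i ≤ D

    module Valid (0<D : 0ℤ < D) (bounded : Bounded) where

      -- A frozen element contributes exactly its colour; a floating one, whose colour is at least
      -- -1, gains at most 2 by rising to 1.
      highest-bound : ∀ S → D * highest S ≤ 1ℤ * value S + + 2 * D * floats S
      highest-bound S = weight-bound S D 1ℤ (+ 2 * D) (λ i → hi (st i)) a (λ i → ι (floating i)) pointwise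
        where
        ring₁ : ∀ D → 1ℤ * D + + 2 * D * 0ℤ ≡ D * 1ℤ
        ring₁ = solve-∀
        ring₂ : ∀ D → 1ℤ * - D + + 2 * D * 0ℤ ≡ D * -1ℤ
        ring₂ = solve-∀
        ring₃ : ∀ D x → x - (- D) ≡ (1ℤ * x + + 2 * D * 1ℤ) - D * 1ℤ
        ring₃ = solve-∀
        pointwise : ∀ i → D * hi (st i) ≤ 1ℤ * a i + + 2 * D * ι (floating i)
        pointwise i with status D (a i) | status-view D (a i)
        ... | top   | top eq    rewrite eq = ≤-reflexive (sym (ring₁ D))
        ... | bot   | bot eq    rewrite eq = ≤-reflexive (sym (ring₂ D))
        ... | float | float _ _ = by (gap (proj₁ (bounded i))) (ring₃ D (a i))

      lowest-bound : ∀ S → D * lowest S ≤ -1ℤ * value S + + 2 * D * floats S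
      lowest-bound S = weight-bound S D -1ℤ (+ 2 * D) (λ i → lo (st i)) a (λ i → ι (floating i)) pointwise
        where
        ring₁ : ∀ D → -1ℤ * D + + 2 * D * 0ℤ ≡ D * -1ℤ
        ring₁ = solve-∀
        ring₂ : ∀ D → -1ℤ * - D + + 2 * D * 0ℤ ≡ D * 1ℤ
        ring₂ = solve-∀
        ring₃ : ∀ D x → D - x ≡ (-1ℤ * x + + 2 * D * 1ℤ) - D * 1ℤ
        ring₃ = solve-∀
        pointwise : ∀ i → D * lo (st i) ≤ -1ℤ * a i + + 2 * D * ι (floating i)
        pointwise i with status D (a i) | status-view D (a i)
        ... | top   | top eq    rewrite eq = ≤-reflexive (sym (ring₁ D))
        ... | bot   | bot eq    rewrite eq = ≤-reflexive (sym (ring₂ D))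
        ... | float | float _ _ = by (gap (proj₂ (bounded i))) (ring₃ D (a i))

      value≤highest : ∀ S → value S ≤ D * highest S
      value≤highest S = by (gap (lowest-bound S)) (ring D (value S) (highest S) (lowest S) (floats S) (highest+lowest S))
        where
        ring′ : ∀ D v h l → (-1ℤ * v + D * (h + l)) - D * l ≡ D * h - v
        ring′ = solve-∀
        ring : ∀ D v h l f → h + l ≡ + 2 * f → (-1ℤ * v + + 2 * D * f) - D * l ≡ D * h - v
        ring D v h l f eq = trans (cong (λ z → -1ℤ * v + z - D * l) (trans (assoc D f) (cong (D *_) (sym eq)))) (ring′ D v h l)
          where
          assoc : ∀ D f → + 2 * D * f ≡ D * (+ 2 * f)
          assoc = solve-∀

      -value≤lowest : ∀ S → - value S ≤ D * lowest S
      -value≤lowest S = by (gap (highest-bound S)) (ring D (value S) (highest S) (lowest S) (floats S) (highest+lowest S))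
        where
        ring′ : ∀ D v h l → (1ℤ * v + D * (h + l)) - D * h ≡ D * l - - v
        ring′ = solve-∀
        ring : ∀ D v h l f → h + l ≡ + 2 * f → (1ℤ * v + + 2 * D * f) - D * h ≡ D * l - - v
        ring D v h l f eq = trans (cong (λ z → 1ℤ * v + z - D * h) (trans (assoc D f) (cong (D *_) (sym eq)))) (ring′ D v h l)
          where
          assoc : ∀ D f → + 2 * D * f ≡ D * (+ 2 * f)
          assoc = solve-∀

      -- The oriented sum plus twice the number of floating elements still exceeds `2d − k`.
      -- Floating elements missing from `d` must therefore be paid for by the sum, two units each.
      deficit : ∀ S → kindOf S ≢ settled → + 2 * D * (d - floats S) ≤ signed S + k * D
      deficit S un = [ over-case , under-case ]′ (unsettled-cases (kind-view (+ 2 * d - k) (highest S) (lowest S)) un)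
        where
        over-case : 1ℤ ≡ orientation (kindOf S) × + 2 * d - k < highest S → + 2 * D * (d - floats S) ≤ signed S + k * D
        over-case (eq , T<h) = deficit-arith D d k (signed S) (highest S) (floats S) (<⇒≤ 0<D)
          (subst (λ o → D * highest S ≤ o * value S + + 2 * D * floats S) eq (highest-bound S)) T<h
        under-case : -1ℤ ≡ orientation (kindOf S) × + 2 * d - k < lowest S → + 2 * D * (d - floats S) ≤ signed S + k * D
        under-case (eq , T<l) = deficit-arith D d k (signed S) (lowest S) (floats S) (<⇒≤ 0<D)
          (subst (λ o → D * lowest S ≤ o * value S + + 2 * D * floats S) eq (lowest-bound S)) T<l

    Small : Fin m → Set
    Small S = floats S ≤ d + + 10 * k

    over⇒lowest : ∀ S → Small S → (+ 2 * d - k) < highest S → lowest S ≤ + 21 * k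
    over⇒lowest S = opposite-arith d k (highest S) (lowest S) (floats S) (highest+lowest S)

    under⇒highest : ∀ S → Small S → (+ 2 * d - k) < lowest S → highest S ≤ + 21 * k
    under⇒highest S = opposite-arith d k (lowest S) (highest S) (floats S) (trans (+-comm (lowest S) (highest S)) (highest+lowest S))

nat : ∀ c → 0ℤ ≤ + c
nat c = +≤+ ℕ.z≤n

-- The constraints are outnumbered by the floating elements

-- U floating elements; H unsettled sets, namely Uf fully linked ones (Ob of which are off by 420k), B big ones and V
-- others; X and Δ are the degrees missing on the side of the sets and of the elements; Ta stars.
module Counting-arith
  (D d k U H Uf V B X Z Δ Y W L Ls Ta Ob : ℤ)
  (0<D : 0ℤ < D) (1≤k : 1ℤ ≤ k) (k≤d : + 466201 * k ≤ d)
  (0≤B : 0ℤ ≤ B) (0≤V : 0ℤ ≤ V) (0≤Ls : 0ℤ ≤ Ls)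
  (H≡ : H ≡ Uf + V + B) (X≡ : X ≡ d * H - Z) (Δ≡ : Δ ≡ d * U - Z)
  (e₁ : + 2 * D * X + + 20 * k * D * B ≤ Y - + 21 * k * D * Uf + k * D * (Uf + V))
  (e₂ : + 3780 * k * Y ≤ W - + 21 * k * D * L + + 21 * k * D * Ls + + 21 * k * D * (+ 4200 * k * Uf))
  (e₃ : W ≤ + 21 * k * D * L)
  (e₄ : Ls ≤ Δ)
  (e₅ : + 46200 * k * Ta ≤ L) (e₅′ : L ≤ + 4200 * k * H + Ls)
  (e₆ : + 441 * k * D * Ob ≤ Y)
  (e₇ : (d - + 4201 * k) * V ≤ + 46200 * k * U)
  (U≤H : U ≤ H) (0<U : 0ℤ < U)
  where

  private
    0≤D : 0ℤ ≤ D
    0≤D = <⇒≤ 0<D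

    0<k : 0ℤ < k
    0<k = <-≤-trans (+<+ (ℕ.s≤s ℕ.z≤n)) 1≤k

    0≤k : 0ℤ ≤ k
    0≤k = <⇒≤ 0<k

    0≤d : 0ℤ ≤ d
    0≤d = ≤-trans (nat 466201 ⊗ 0≤k) k≤d

    0<c*k : ∀ c → 0ℤ < + ℕ.suc c * k
    0<c*k c = subst (_< + ℕ.suc c * k) (*-zeroʳ (+ ℕ.suc c)) (*-monoˡ-<-pos (+ ℕ.suc c) 0<k)

    -- The mass, weighted by floating links, is at most `21kD` on average by `e₃`, and a fully
    -- linked set has at least `3780k` such links; 180 is 3780 / 21.
    s₁ : + 180 * Y ≤ D * (Δ + + 4200 * k * Uf)
    s₁ = cancel-pos (0<c*k 20) (by (gap e₂ ⊕ gap e₃ ⊕ nat 21 ⊗ 0≤k ⊗ 0≤D ⊗ gap e₄) (ring k D Y W L Ls Δ Uf))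
      where
      ring : ∀ k D Y W L Ls Δ Uf →
        (W - + 21 * k * D * L + + 21 * k * D * Ls + + 21 * k * D * (+ 4200 * k * Uf) - + 3780 * k * Y)
        + (+ 21 * k * D * L - W) + + 21 * k * D * (Δ - Ls)
        ≡ + 21 * k * (D * (Δ + + 4200 * k * Uf)) - + 21 * k * (+ 180 * Y)
      ring = solve-∀

    -- `s₁` is fed into `e₁`: of the `4200k` for each fully linked set, the term `−20k` takes away
    -- `180 · 20k = 3600k`, and `600k` is left.
    s₂ : + 360 * X + + 3600 * k * B ≤ Δ + + 600 * k * Uf + + 180 * k * V
    s₂ = cancel-pos 0<D (by (nat 180 ⊗ gap e₁ ⊕ gap s₁) (ring k D X B Y Uf V Δ))
      where
      ring : ∀ k D X B Y Uf V Δ →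
        + 180 * (Y - + 21 * k * D * Uf + k * D * (Uf + V) - (+ 2 * D * X + + 20 * k * D * B))
        + (D * (Δ + + 4200 * k * Uf) - + 180 * Y)
        ≡ D * (Δ + + 600 * k * Uf + + 180 * k * V) - D * (+ 360 * X + + 3600 * k * B)
      ring = solve-∀

    -- Both are measured against the same incidences `Z`, and unsettled sets are at least as many as
    -- floating elements.
    s₃ : Δ ≤ X
    s₃ = by (0≤d ⊗ gap U≤H) (trans (ring d H U Z) (sym (cong₂ _-_ X≡ Δ≡)))
      where
      ring : ∀ d H U Z → d * (H - U) ≡ (d * H - Z) - (d * U - Z)
      ring = solve-∀

    0≤X : 0ℤ ≤ X
    0≤X = ≤-trans 0≤Ls (≤-trans e₄ s₃)

    0≤H : 0ℤ ≤ H
    0≤H = ≤-trans (<⇒≤ 0<U) U≤H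

    -- One of the 360 copies of `X` absorbs `Δ`; the right-hand side is rounded up to `600k` for
    -- every unsettled set.
    s₄ : + 359 * X + + 3600 * k * B ≤ + 600 * k * H
    s₄ = by (gap s₂ ⊕ gap s₃ ⊕ nat 420 ⊗ 0≤k ⊗ 0≤V ⊕ nat 600 ⊗ 0≤k ⊗ 0≤B)
      (trans (ring k X B Δ Uf V) (cong (λ h → + 600 * k * h - (+ 359 * X + + 3600 * k * B)) (sym H≡)))
      where
      ring : ∀ k X B Δ Uf V →
        (Δ + + 600 * k * Uf + + 180 * k * V - (+ 360 * X + + 3600 * k * B)) + (X - Δ) + + 420 * k * V + + 600 * k * B
        ≡ + 600 * k * (Uf + V + B) - (+ 359 * X + + 3600 * k * B)
      ring = solve-∀

    s₅ : X ≤ + 2 * k * H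
    s₅ = cancel-pos {z = + 359} (+<+ (ℕ.s≤s ℕ.z≤n)) (by (gap s₄ ⊕ nat 3600 ⊗ 0≤k ⊗ 0≤B ⊕ nat 118 ⊗ 0≤k ⊗ 0≤H) (ring k X B H))
      where
      ring : ∀ k X B H → (+ 600 * k * H - (+ 359 * X + + 3600 * k * B)) + + 3600 * k * B + + 118 * k * H
        ≡ + 359 * (+ 2 * k * H) - + 359 * X
      ring = solve-∀

    s₅′ : + 6 * B ≤ H
    s₅′ = cancel-pos (0<c*k 599) (by (gap s₄ ⊕ nat 359 ⊗ 0≤X) (ring k X B H))
      where
      ring : ∀ k X B H → (+ 600 * k * H - (+ 359 * X + + 3600 * k * B)) + + 359 * X ≡ + 600 * k * H - + 600 * k * (+ 6 * B)
      ring = solve-∀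

    Δ≤ : Δ ≤ + 2 * k * H
    Δ≤ = ≤-trans s₃ s₅

    -- A star has at least 11 times as many members as a set has links. The links of settled sets
    -- add at most `2kH`, so the factor 10 survives.
    s₆ : + 10 * Ta ≤ H
    s₆ = cancel-pos (0<c*k 4619) (by (gap e₅ ⊕ gap e₅′ ⊕ gap e₄ ⊕ gap Δ≤ ⊕ nat 418 ⊗ 0≤k ⊗ 0≤H) (ring k Ta L Ls Δ H))
      where
      ring : ∀ k Ta L Ls Δ H → (L - + 46200 * k * Ta) + (+ 4200 * k * H + Ls - L) + (Δ - Ls) + (+ 2 * k * H - Δ) + + 418 * k * H
        ≡ + 4620 * k * H - + 4620 * k * (+ 10 * Ta)
      ring = solve-∀

    Uf≤H : Uf ≤ H
    Uf≤H = by (0≤V ⊕ 0≤B) (trans (ring Uf V B) (cong (_- Uf) (sym H≡)))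
      where
      ring : ∀ Uf V B → V + B ≡ Uf + V + B - Uf
      ring = solve-∀

    -- A tight set has mass at least `(420 + 21)kD`, while `s₁` bounds the total mass of fully
    -- linked sets by `4202kDH / 180`.
    s₇ : + 18 * Ob ≤ H
    s₇ = cancel-pos (0<c*k 4409) (cancel-pos 0<D (by
      (nat 180 ⊗ gap e₆ ⊕ gap s₁ ⊕ 0≤D ⊗ gap Δ≤ ⊕ nat 4200 ⊗ 0≤k ⊗ 0≤D ⊗ gap Uf≤H ⊕ nat 208 ⊗ 0≤k ⊗ 0≤D ⊗ 0≤H)
      (ring k D Ob Y Δ Uf H)))
      where
      ring : ∀ k D Ob Y Δ Uf H →
        + 180 * (Y - + 441 * k * D * Ob) + (D * (Δ + + 4200 * k * Uf) - + 180 * Y) + D * (+ 2 * k * H - Δ)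
        + + 4200 * k * D * (H - Uf) + + 208 * k * D * H
        ≡ D * (+ 4410 * k * H) - D * (+ 4410 * k * (+ 18 * Ob))
      ring = solve-∀

    -- The constant in `k≤d` is chosen for this bound: 466201 = 10 · 46200 + 4201.
    s₈ : + 10 * V ≤ U
    s₈ = cancel-pos (0<c*k 46199) (by (gap e₇ ⊕ gap k≤d ⊗ 0≤V) (ring d k U V))
      where
      ring : ∀ d k U V → (+ 46200 * k * U - (d - + 4201 * k) * V) + (d - + 466201 * k) * V ≡ + 46200 * k * U - + 46200 * k * (+ 10 * V)
      ring = solve-∀

    -- This follows from `d(H − U) ≤ X ≤ 2kH` and `4k ≤ d`.
    s₉ : H ≤ + 2 * U
    s₉ = cancel-pos (0<c*k 1) (by (gap s₅ ⊕ gap (≤-trans 0≤Ls e₄) ⊕ (gap k≤d ⊕ nat 466197 ⊗ 0≤k) ⊗ gap U≤H)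
      (trans (cong₂ (λ x δ → (+ 2 * k * H - x) + (δ - 0ℤ) + (d - + 466201 * k + + 466197 * k) * (H - U)) X≡ Δ≡) (ring d k H U Z)))
      where
      ring : ∀ d k H U Z → (+ 2 * k * H - (d * H - Z)) + (d * U - Z - 0ℤ) + (d - + 466201 * k + + 466197 * k) * (H - U)
        ≡ + 2 * k * (+ 2 * U) - + 2 * k * H
      ring = solve-∀

  -- With `H ≤ 2U` the four bounds add up to `(2/10 + 2/6 + 1/10 + 2/18)U = 67U/90`; the rest makes
  -- the inequality strict because `U` is positive.
  count< : Ta + (B + V + Ob) < U
  count< = *-cancelˡ-<-nonNeg (+ 90) (by< (nat 9 ⊗ gap s₆ ⊕ nat 15 ⊗ gap s₅′ ⊕ nat 9 ⊗ gap s₈ ⊕ nat 5 ⊗ gap s₇ ⊕ nat 29 ⊗ gap s₉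
      ⊕ nat 22 ⊗ <⇒≤ 0<U ⊕ gap< 0<U)
    (ring Ta B V Ob H U))
    where
    ring : ∀ Ta B V Ob H U → + 9 * (H - + 10 * Ta) + + 15 * (H - + 6 * B) + + 9 * (U - + 10 * V) + + 5 * (H - + 18 * Ob)
      + + 29 * (+ 2 * U - H) + + 22 * U + (U - 0ℤ - 1ℤ) ≡ + 90 * U - + 90 * (Ta + (B + V + Ob)) - 1ℤ
    ring = solve-∀

∑-nonneg-combination : ∀ {n} c₁ c₂ c₃ c₄ c₅ (f₁ f₂ f₃ f₄ f₅ : Fin n → ℤ) →
  (∀ i → 0ℤ ≤ c₁ * f₁ i + c₂ * f₂ i + c₃ * f₃ i + c₄ * f₄ i + c₅ * f₅ i) →
  0ℤ ≤ c₁ * ∑ f₁ + c₂ * ∑ f₂ + c₃ * ∑ f₃ + c₄ * ∑ f₄ + c₅ * ∑ f₅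
∑-nonneg-combination c₁ c₂ c₃ c₄ c₅ f₁ f₂ f₃ f₄ f₅ 0≤ = subst (0ℤ ≤_) eq (∑-nonneg 0≤)
  where
  eq : ∑ (λ i → c₁ * f₁ i + c₂ * f₂ i + c₃ * f₃ i + c₄ * f₄ i + c₅ * f₅ i) ≡ c₁ * ∑ f₁ + c₂ * ∑ f₂ + c₃ * ∑ f₃ + c₄ * ∑ f₄ + c₅ * ∑ f₅
  eq = trans (∑-+ _ _) (cong₂ _+_ (trans (∑-+ _ _) (cong₂ _+_ (trans (∑-+ _ _) (cong₂ _+_ (∑-linear c₁ c₂ f₁ f₂) (∑-* c₃ f₃))) (∑-* c₄ f₄))) (∑-* c₅ f₅))

∑-scale-≤ : ∀ {n} c {f g : Fin n → ℤ} → (∀ i → c * f i ≤ g i) → c * ∑ f ≤ ∑ g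
∑-scale-≤ c {f} le = ≤-trans (≤-reflexive (sym (∑-* c f))) (∑-mono le)

-- An unsettled set which is not fully linked is big or spare; otherwise it is tight if it is off by 420k.
data Class : Set where
  closed big spare loose tight : Class

isOpen isFull isSpare isBig isTight : Class → Bool
isOpen closed = false
isOpen _      = true
isFull loose = true
isFull tight = true
isFull _     = false
isSpare spare = true
isSpare _     = false
isBig big = true
isBig _   = false
isTight tight = true
isTight _     = false

isHeld : Class → Bool
isHeld c = isBig c ∨ isSpare c ∨ isTight c

-- What the invariant says about a set of each class, indexed by the indicators of being unsettled, fully linked,
-- spare, big and tight.
data Profile (D d k f M l cs : ℤ) : ℤ → ℤ → ℤ → ℤ → ℤ → Set where
  closed : M ≡ 0ℤ → Profile D d k f M l cs 0ℤ 0ℤ 0ℤ 0ℤ 0ℤ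
  big    : M ≡ + 21 * k * D → d + + 10 * k < f → Profile D d k f M l cs 1ℤ 0ℤ 0ℤ 1ℤ 0ℤ
  spare  : M ≡ + 21 * k * D → + 2 * D * (d - f) ≤ k * D → d - + 4201 * k ≤ cs → Profile D d k f M l cs 1ℤ 0ℤ 1ℤ 0ℤ 0ℤ
  loose  : 0ℤ ≤ M → + 2 * D * (d - f) ≤ M - + 20 * k * D → + 3780 * k ≤ l → Profile D d k f M l cs 1ℤ 1ℤ 0ℤ 0ℤ 0ℤ
  tight  : 0ℤ ≤ M → + 2 * D * (d - f) ≤ M - + 20 * k * D → + 3780 * k ≤ l → + 441 * k * D ≤ M → Profile D d k f M l cs 1ℤ 1ℤ 0ℤ 0ℤ 1ℤ

-- Each lemma gives the contribution of one set to a hypothesis of `Counting-arith`, in a form that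
-- can be summed term by term.
module Pointwise (D d k f M l cs : ℤ) (0≤D : 0ℤ ≤ D) (0≤k : 0ℤ ≤ k) (0≤cs : 0ℤ ≤ cs) (l≤ : l ≤ + 4200 * k) where

  deficits : ∀ {υ uf uv ub ob} → Profile D d k f M l cs υ uf uv ub ob →
    0ℤ ≤ - (+ 2 * D) * (υ * (d - f)) + - (+ 20 * k * D) * ub + 1ℤ * (uf * M) + (- (+ 20 * k * D)) * uf + k * D * uv
  deficits (closed refl) = ≤-reflexive (ring D d k f)
    where
    ring : ∀ D d k f → 0ℤ ≡ - (+ 2 * D) * (0ℤ * (d - f)) + - (+ 20 * k * D) * 0ℤ + 1ℤ * (0ℤ * 0ℤ) + (- (+ 20 * k * D)) * 0ℤ + k * D * 0ℤ
    ring = solve-∀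
  deficits (big refl huge) = subst (0ℤ ≤_) (ring D d k f) (nat 2 ⊗ 0≤D ⊗ (gap< huge ⊕ nat 1))
    where
    ring : ∀ D d k f → + 2 * D * (f - (d + + 10 * k) - 1ℤ + 1ℤ) ≡
      - (+ 2 * D) * (1ℤ * (d - f)) + - (+ 20 * k * D) * 1ℤ + 1ℤ * (0ℤ * (+ 21 * k * D)) + (- (+ 20 * k * D)) * 0ℤ + k * D * 0ℤ
    ring = solve-∀
  deficits (spare refl def _) = subst (0ℤ ≤_) (ring D d k f) (gap def)
    where
    ring : ∀ D d k f → k * D - + 2 * D * (d - f) ≡
      - (+ 2 * D) * (1ℤ * (d - f)) + - (+ 20 * k * D) * 0ℤ + 1ℤ * (0ℤ * (+ 21 * k * D)) + (- (+ 20 * k * D)) * 0ℤ + k * D * 1ℤ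
    ring = solve-∀
  deficits (loose _ def _) = subst (0ℤ ≤_) (ring D d k f M) (gap def)
    where
    ring : ∀ D d k f M → M - + 20 * k * D - + 2 * D * (d - f) ≡
      - (+ 2 * D) * (1ℤ * (d - f)) + - (+ 20 * k * D) * 0ℤ + 1ℤ * (1ℤ * M) + (- (+ 20 * k * D)) * 1ℤ + k * D * 0ℤ
    ring = solve-∀
  deficits (tight 0≤M def m _) = deficits (loose 0≤M def m)

  masses : ∀ {υ uf uv ub ob} → Profile D d k f M l cs υ uf uv ub ob →
    0ℤ ≤ - (+ 3780 * k) * (uf * M) + 1ℤ * (M * l) + - (+ 21 * k * D) * l + + 21 * k * D * ((1ℤ - υ) * l) + + 21 * k * D * (+ 4200 * k) * uf
  masses (closed refl) = ≤-reflexive (ring D k l)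
    where
    ring : ∀ D k l → 0ℤ ≡ - (+ 3780 * k) * (0ℤ * 0ℤ) + 1ℤ * (0ℤ * l) + - (+ 21 * k * D) * l + + 21 * k * D * ((1ℤ - 0ℤ) * l) + + 21 * k * D * (+ 4200 * k) * 0ℤ
    ring = solve-∀
  masses (big refl _) = ≤-reflexive (ring D k l)
    where
    ring : ∀ D k l → 0ℤ ≡ - (+ 3780 * k) * (0ℤ * (+ 21 * k * D)) + 1ℤ * (+ 21 * k * D * l) + - (+ 21 * k * D) * l + + 21 * k * D * ((1ℤ - 1ℤ) * l) + + 21 * k * D * (+ 4200 * k) * 0ℤ
    ring = solve-∀
  masses (spare refl _ _) = ≤-reflexive (ring D k l)
    where
    ring : ∀ D k l → 0ℤ ≡ - (+ 3780 * k) * (0ℤ * (+ 21 * k * D)) + 1ℤ * (+ 21 * k * D * l) + - (+ 21 * k * D) * l + + 21 * k * D * ((1ℤ - 1ℤ) * l) + + 21 * k * D * (+ 4200 * k) * 0ℤ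
    ring = solve-∀
  -- Two nonnegative products suffice: the many floating links make `M(l − 3780k)` nonnegative, the
  -- cap on links `21kD(4200k − l)`.
  masses (loose 0≤M _ many) = subst (0ℤ ≤_) (ring D k l M) (0≤M ⊗ gap many ⊕ nat 21 ⊗ 0≤k ⊗ 0≤D ⊗ gap l≤)
    where
    ring : ∀ D k l M → M * (l - + 3780 * k) + + 21 * k * D * (+ 4200 * k - l) ≡
      - (+ 3780 * k) * (1ℤ * M) + 1ℤ * (M * l) + - (+ 21 * k * D) * l + + 21 * k * D * ((1ℤ - 1ℤ) * l) + + 21 * k * D * (+ 4200 * k) * 1ℤ
    ring = solve-∀
  masses (tight 0≤M def m _) = masses (loose 0≤M def m)

  links-shared : ∀ {υ uf uv ub ob} → Profile D d k f M l cs υ uf uv ub ob → l ≤ + 4200 * k * υ + 1ℤ * ((1ℤ - υ) * l)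
  links-shared = λ where
      (closed _)      → ≤-reflexive (ring k l)
      (big _ _)       → one
      (spare _ _ _)   → one
      (loose _ _ _)   → one
      (tight _ _ _ _) → one
    where
    ring : ∀ k l → l ≡ + 4200 * k * 0ℤ + 1ℤ * ((1ℤ - 0ℤ) * l)
    ring = solve-∀
    ring′ : ∀ k l → + 4200 * k ≡ + 4200 * k * 1ℤ + 1ℤ * ((1ℤ - 1ℤ) * l)
    ring′ = solve-∀
    one : l ≤ + 4200 * k * 1ℤ + 1ℤ * ((1ℤ - 1ℤ) * l)
    one = ≤-trans l≤ (≤-reflexive (ring′ k l))

  tights : ∀ {υ uf uv ub ob} → Profile D d k f M l cs υ uf uv ub ob → + 441 * k * D * ob ≤ uf * M
  tights = λ where
      (closed _)          → zero-case M
      (big _ _)           → zero-case M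
      (spare _ _ _)       → zero-case M
      (loose 0≤M _ _)     → ≤-trans (≤-reflexive (*-zeroʳ (+ 441 * k * D))) (≤-trans 0≤M (≤-reflexive (sym (*-identityˡ M))))
      (tight _ _ _ heavy) → ≤-trans (≤-reflexive (*-identityʳ (+ 441 * k * D))) (≤-trans heavy (≤-reflexive (sym (*-identityˡ M))))
    where
    zero-case : ∀ M → + 441 * k * D * 0ℤ ≤ 0ℤ * M
    zero-case M = ≤-reflexive (trans (*-zeroʳ (+ 441 * k * D)) (sym (*-zeroˡ M)))

  spares : ∀ {υ uf uv ub ob} → Profile D d k f M l cs υ uf uv ub ob → (d - + 4201 * k) * uv ≤ cs
  spares = λ where
      (closed _)         → zero-case
      (big _ _)          → zero-case
      (spare _ _ enough) → ≤-trans (≤-reflexive (*-identityʳ (d - + 4201 * k))) enough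
      (loose _ _ _)      → zero-case
      (tight _ _ _ _)    → zero-case
    where
    zero-case : (d - + 4201 * k) * 0ℤ ≤ cs
    zero-case = ≤-trans (≤-reflexive (*-zeroʳ (d - + 4201 * k))) 0≤cs

  open-split : ∀ {υ uf uv ub ob} → Profile D d k f M l cs υ uf uv ub ob → υ ≡ uf + uv + ub
  open-split (closed _)      = refl
  open-split (big _ _)       = refl
  open-split (spare _ _ _)   = refl
  open-split (loose _ _ _)   = refl
  open-split (tight _ _ _ _) = refl

-- Links, classes and the invariant

over-arith : ∀ D k v l → 0ℤ ≤ D → l ≤ + 21 * k → - v ≤ D * l → 0ℤ ≤ + 21 * k * D + 1ℤ * v
over-arith D k v l 0≤D l≤ -v≤ = subst (0ℤ ≤_) (ring D k v l) (0≤D ⊗ gap l≤ ⊕ gap -v≤)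
  where
  ring : ∀ D k v l → D * (+ 21 * k - l) + (D * l - - v) ≡ + 21 * k * D + 1ℤ * v
  ring = solve-∀

under-arith : ∀ D k v h → 0ℤ ≤ D → h ≤ + 21 * k → v ≤ D * h → 0ℤ ≤ + 21 * k * D + -1ℤ * v
under-arith D k v h 0≤D h≤ v≤ = subst (0ℤ ≤_) (ring D k v h) (0≤D ⊗ gap h≤ ⊕ gap v≤)
  where
  ring : ∀ D k v h → D * (+ 21 * k - h) + (D * h - v) ≡ + 21 * k * D + -1ℤ * v
  ring = solve-∀

live-arith : ∀ D d k f g l w → 0ℤ < D → 0ℤ ≤ k → + 4200 * k ≤ g → f + g - l ≤ d + + 10 * k →
  + 2 * D * (d - f) ≤ w + k * D → w ≤ + 420 * k * D → + 3780 * k ≤ l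
live-arith D d k f g l w 0<D 0≤k full room def tame = cancel-pos {z = + 2} (+<+ (ℕ.s≤s ℕ.z≤n)) (cancel-pos 0<D (by
    (<⇒≤ 0<D ⊗ (nat 2 ⊗ gap full ⊕ nat 2 ⊗ gap room ⊕ nat 399 ⊗ 0≤k) ⊕ gap def ⊕ gap tame)
    (ring D d k f g l w)))
  where
  ring : ∀ D d k f g l w →
    D * (+ 2 * (g - + 4200 * k) + + 2 * (d + + 10 * k - (f + g - l)) + + 399 * k) + (w + k * D - + 2 * D * (d - f)) + (+ 420 * k * D - w)
    ≡ D * (+ 2 * l) - D * (+ 2 * (+ 3780 * k))
  ring = solve-∀

-- An unsettled set with sum 0 has at least `d − k/2` floating elements. At most `4200k` elements
-- are linked, and `k/2` is rounded up to `k`.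
spare-arith : ∀ D d k f g → 0ℤ < D → 0ℤ ≤ k → + 2 * D * (d - f) ≤ k * D → g ≤ + 4200 * k → d - + 4201 * k ≤ f - g
spare-arith D d k f g 0<D 0≤k def few = cancel-pos {z = + 2} (+<+ (ℕ.s≤s ℕ.z≤n)) (cancel-pos 0<D (by
    (<⇒≤ 0<D ⊗ (nat 2 ⊗ gap few ⊕ 0≤k) ⊕ gap def)
    (ring D d k f g)))
  where
  ring : ∀ D d k f g → D * (+ 2 * (+ 4200 * k - g) + k) + (k * D - + 2 * D * (d - f)) ≡ D * (+ 2 * (f - g)) - D * (+ 2 * (d - + 4201 * k))
  ring = solve-∀

ι-union : ∀ x f g → (g ≡ true → x ≡ true) → ι x * ι (f ∨ g) ≡ ι x * ι f + ι g - ι g * ι f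
ι-union true  true  true  _ = refl
ι-union true  true  false _ = refl
ι-union true  false true  _ = refl
ι-union true  false false _ = refl
ι-union false true  true  s = ⊥-elim (false≢true (s refl))
ι-union false true  false _ = refl
ι-union false false true  s = ⊥-elim (false≢true (s refl))
ι-union false false false _ = refl

settled? : (κ : Kind) → Dec (κ ≡ settled)
settled? over    = no λ ()
settled? under   = no λ ()
settled? settled = yes refl

module Bundles (m n : ℕ) (A : Fin m → Fin n → Bool) (d k : ℤ)
  (1≤k : 1ℤ ≤ k) where

  open System m n A d k public

  0≤k : 0ℤ ≤ k
  0≤k = ≤-trans (nat 1) 1≤k

  -- G S i says that S belongs to the star with centre i.
  module Linked (D : ℤ) (a : Fin n → ℤ) (G : Fin m → Fin n → Bool) where

    open Colour D a public

    -- `span` counts frozen links too. Hence it does not grow when a floating element is linked, nor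
    -- when elements freeze, and so its bound `d + 10k` persists.
    links live span : Fin m → ℤ
    links S = ∑ λ i → ι (G S i)
    live  S = ∑ λ i → ι (G S i) * ι (floating i)
    span  S = weight S λ i → ι (floating i ∨ G S i)

    members : Fin n → ℤ
    members i = ∑ λ S → ι (G S i)

    classify : ∀ {O P Q R : Set} → Dec O → Dec P → Dec Q → Dec R → Class
    classify (yes _) _       _       _       = closed
    classify (no  _) (yes _) (yes _) _       = spare
    classify (no  _) (yes _) (no  _) _       = big
    classify (no  _) (no  _) _       (yes _) = loose
    classify (no  _) (no  _) _       (no  _) = tight

    classOf : Fin m → Class
    classOf S = classify (settled? (kindOf S)) (links S <? + 4200 * k) (floats S ≤? d + + 10 * k) (signed S <? + 420 * k * D)

    data ClassView (S : Fin m) : Class → Set where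
      closed : kindOf S ≡ settled → ClassView S closed
      big    : kindOf S ≢ settled → links S < + 4200 * k → d + + 10 * k < floats S → ClassView S big
      spare  : kindOf S ≢ settled → links S < + 4200 * k → Small S → ClassView S spare
      loose  : kindOf S ≢ settled → + 4200 * k ≤ links S → signed S < + 420 * k * D → ClassView S loose
      tight  : kindOf S ≢ settled → + 4200 * k ≤ links S → + 420 * k * D ≤ signed S → ClassView S tight

    classView : ∀ S → ClassView S (classOf S)
    classView S = go (settled? (kindOf S)) (links S <? + 4200 * k) (floats S ≤? d + + 10 * k) (signed S <? + 420 * k * D)
      where
      go : (o : Dec (kindOf S ≡ settled)) (p : Dec (links S < + 4200 * k)) (q : Dec (floats S ≤ d + + 10 * k)) (r : Dec (signed S < + 420 * k * D)) →
        ClassView S (classify o p q r)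
      go (yes o) _       _       _       = closed o
      go (no  o) (yes p) (yes q) _       = spare o p q
      go (no  o) (yes p) (no  q) _       = big o p (≰⇒> q)
      go (no  o) (no  p) _       (yes r) = loose o (≮⇒≥ p) r
      go (no  o) (no  p) _       (no  r) = tight o (≮⇒≥ p) (≮⇒≥ r)

    -- The side and the bound `21k` on the opposite extreme come from the present state, the sum `v`
    -- from a possibly later one with smaller extremes. This covers sets that settle during a move
    -- and thereby lose their side.
    oriented≥0 : ∀ S → Small S → kindOf S ≢ settled → ∀ {D′ v h l} → 0ℤ ≤ D′ → h ≤ highest S → l ≤ lowest S →
      v ≤ D′ * h → - v ≤ D′ * l → 0ℤ ≤ + 21 * k * D′ + orientation (kindOf S) * v
    oriented≥0 S small un {D′} {v} {h} {l} 0≤D′ h≤ l≤ v≤ -v≤ =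
      [ (λ (eq , T<h) → subst (λ o → 0ℤ ≤ + 21 * k * D′ + o * v) eq (over-arith D′ k v l 0≤D′ (≤-trans l≤ (over⇒lowest S small T<h)) -v≤))
      , (λ (eq , T<l) → subst (λ o → 0ℤ ≤ + 21 * k * D′ + o * v) eq (under-arith D′ k v h 0≤D′ (≤-trans h≤ (under⇒highest S small T<l)) v≤))
      ]′ (unsettled-cases (kind-view (+ 2 * d - k) (highest S) (lowest S)) un)

    -- mass is nonnegative on linked sets and vanishes on settled ones, so the bound in shared survives the settling of
    -- members of a star.
    record Invariant : Set where
      field
        0<D      : 0ℤ < D
        bounded  : Bounded
        link⇒∈   : ∀ S i → G S i ≡ true → A S i ≡ true
        links≤   : ∀ S → links S ≤ + 4200 * k
        span≤    : ∀ S → 0ℤ < links S → span S ≤ d + + 10 * k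
        balanced : ∀ S → kindOf S ≢ settled → links S < + 4200 * k → value S ≡ 0ℤ
        tame     : ∀ S → kindOf S ≢ settled → signed S ≤ + 420 * k * D
        shared   : ∀ i → floating i ≡ true → ∑ (λ S → ι (G S i) * mass S) ≤ + 21 * k * D * members i
        crowded  : ∀ i → floating i ≡ true → members i ≡ 0ℤ ⊎ + 46200 * k ≤ members i

    candidate : Fin m → Fin n → Bool
    candidate S i = isSpare (classOf S) ∧ (A S i ∧ not (G S i))

    candidates : Fin n → ℤ
    candidates i = ∑ λ S → ι (candidate S i)

    -- More than `46200k` candidates at a floating element would suffice to form or enlarge a star
    -- there.
    Saturated : Set
    Saturated = ∀ i → floating i ≡ true → candidates i ≤ + 46200 * k

    unsettled≡1 : ∀ {κ} → κ ≢ settled → ι (unsettled κ) ≡ 1ℤ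
    unsettled≡1 {over}    _  = refl
    unsettled≡1 {under}   _  = refl
    unsettled≡1 {settled} un = ⊥-elim (un refl)

    mass-open : ∀ S → kindOf S ≢ settled → mass S ≡ + 21 * k * D + signed S
    mass-open S un = cong (_+ signed S) (trans (cong (_* (+ 21 * k * D)) (unsettled≡1 un)) (*-identityˡ (+ 21 * k * D)))

    mass-closed : ∀ S → kindOf S ≡ settled → mass S ≡ 0ℤ
    mass-closed S eq = trans (cong (λ κ → ι (unsettled κ) * (+ 21 * k * D) + orientation κ * value S) eq)
      (ring (+ 21 * k * D) (value S))
      where
      ring : ∀ x y → 0ℤ * x + 0ℤ * y ≡ 0ℤ
      ring = solve-∀

    span-split : (∀ S i → G S i ≡ true → A S i ≡ true) → ∀ S → span S ≡ floats S + links S - live S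
    span-split link⇒∈ S = trans (∑-cong λ i → ι-union (A S i) (floating i) (G S i) (link⇒∈ S i))
      (trans (∑-minus (λ i → ι (A S i) * ι (floating i) + ι (G S i)) (λ i → ι (G S i) * ι (floating i)))
        (cong (_- live S) (∑-+ (λ i → ι (A S i) * ι (floating i)) (λ i → ι (G S i)))))

    live≤links : ∀ S → live S ≤ links S
    live≤links S = ∑-mono λ i → pointwise (G S i) (floating i)
      where
      pointwise : ∀ g f → ι g * ι f ≤ ι g
      pointwise true  true  = ≤-refl
      pointwise true  false = nat 1
      pointwise false _     = ≤-refl

    0≤live : ∀ S → 0ℤ ≤ live S
    0≤live S = ∑-nonneg λ i → 0≤ι (G S i) ⊗ 0≤ι (floating i)

    module Consequences (inv : Invariant) where

      open Invariant inv
      open Valid 0<D bounded public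

      0≤D : 0ℤ ≤ D
      0≤D = <⇒≤ 0<D

      mass-balanced : ∀ S → kindOf S ≢ settled → links S < + 4200 * k → mass S ≡ + 21 * k * D
      mass-balanced S un few = trans (mass-open S un)
        (trans (cong (λ v → + 21 * k * D + orientation (kindOf S) * v) (balanced S un few))
          (ring (+ 21 * k * D) (orientation (kindOf S))))
        where
        ring : ∀ x y → x + y * 0ℤ ≡ x
        ring = solve-∀

      deficit-balanced : ∀ S → kindOf S ≢ settled → links S < + 4200 * k → + 2 * D * (d - floats S) ≤ k * D
      deficit-balanced S un few = ≤-trans (deficit S un)
        (≤-reflexive (trans (cong (λ v → orientation (kindOf S) * v + k * D) (balanced S un few)) (ring (orientation (kindOf S)) (k * D))))
        where
        ring : ∀ y x → y * 0ℤ + x ≡ x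
        ring = solve-∀

      linked⇒small : ∀ S → 0ℤ < links S → Small S
      linked⇒small S linked = ≤-trans (by (gap (live≤links S)) (ring (floats S) (links S) (live S)))
        (≤-trans (≤-reflexive (sym (span-split link⇒∈ S))) (span≤ S linked))
        where
        ring : ∀ f l v → l - v ≡ f + l - v - f
        ring = solve-∀

      mass≥0 : ∀ S → Small S → 0ℤ ≤ mass S
      mass≥0 S small with settled? (kindOf S)
      ... | yes eq = ≤-reflexive (sym (mass-closed S eq))
      ... | no  un = ≤-trans (oriented≥0 S small un 0≤D ≤-refl ≤-refl (value≤highest S) (-value≤lowest S)) (≤-reflexive (sym (mass-open S un)))

      full⇒linked : ∀ S → + 4200 * k ≤ links S → 0ℤ < links S
      full⇒linked S full = <-≤-trans (+<+ (ℕ.s≤s ℕ.z≤n)) (≤-trans (≤-trans 1≤k (by (nat 4199 ⊗ 0≤k) (ring k))) full)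
        where
        ring : ∀ k → + 4199 * k ≡ + 4200 * k - k
        ring = solve-∀

      full⇒small : ∀ S → + 4200 * k ≤ links S → Small S
      full⇒small S full = linked⇒small S (full⇒linked S full)

      live≥ : ∀ S → kindOf S ≢ settled → + 4200 * k ≤ links S → + 3780 * k ≤ live S
      live≥ S un full = live-arith D d k (floats S) (links S) (live S) (signed S) 0<D 0≤k full
        (≤-trans (≤-reflexive (sym (span-split link⇒∈ S))) (span≤ S (full⇒linked S full))) (deficit S un) (tame S un)

      spareness : Fin m → ℤ
      spareness S = ∑ λ i → ι (floating i) * ι (candidate S i)

      0≤spareness : ∀ S → 0ℤ ≤ spareness S
      0≤spareness S = ∑-nonneg λ i → 0≤ι (floating i) ⊗ 0≤ι (candidate S i)

      spareness≥ : ∀ S → classOf S ≡ spare → floats S - links S ≤ spareness S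
      spareness≥ S eq = ≤-trans (≤-reflexive (sym (∑-minus (λ i → ι (A S i) * ι (floating i)) (λ i → ι (G S i)))))
        (∑-mono λ i → ≤-trans (pointwise (A S i) (floating i) (G S i))
          (≤-reflexive (cong (λ c → ι (floating i) * ι (isSpare c ∧ (A S i ∧ not (G S i)))) (sym eq))))
        where
        pointwise : ∀ x f g → ι x * ι f - ι g ≤ ι f * ι (true ∧ (x ∧ not g))
        pointwise true  true  true  = ≤-refl
        pointwise true  true  false = ≤-refl
        pointwise true  false true  = -≤+
        pointwise true  false false = ≤-refl
        pointwise false true  true  = -≤+
        pointwise false true  false = ≤-refl
        pointwise false false true  = -≤+
        pointwise false false false = ≤-refl

      profile : ∀ S → let c = classOf S in
        Profile D d k (floats S) (mass S) (live S) (spareness S) (ι (isOpen c)) (ι (isFull c)) (ι (isSpare c)) (ι (isBig c)) (ι (isTight c))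
      profile S = go (classOf S) refl (classView S)
        where
        heavier : kindOf S ≢ settled → + 2 * D * (d - floats S) ≤ mass S - + 20 * k * D
        heavier un = ≤-trans (deficit S un) (≤-reflexive (trans (ring k D (signed S)) (cong (_- + 20 * k * D) (sym (mass-open S un)))))
          where
          ring : ∀ k D s → s + k * D ≡ + 21 * k * D + s - + 20 * k * D
          ring = solve-∀

        go : ∀ c → classOf S ≡ c → ClassView S c →
          Profile D d k (floats S) (mass S) (live S) (spareness S) (ι (isOpen c)) (ι (isFull c)) (ι (isSpare c)) (ι (isBig c)) (ι (isTight c))
        go _ _  (closed eq)       = closed (mass-closed S eq)
        go _ _  (big un few huge) = big (mass-balanced S un few) huge
        go _ eq (spare un few _)  = spare (mass-balanced S un few) (deficit-balanced S un few)
          (≤-trans (spare-arith D d k (floats S) (links S) 0<D 0≤k (deficit-balanced S un few) (<⇒≤ few)) (spareness≥ S eq))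
        go _ _  (loose un full _) = loose (mass≥0 S (full⇒small S full)) (heavier un) (live≥ S un full)
        go _ _  (tight un full h) = tight (mass≥0 S (full⇒small S full)) (heavier un) (live≥ S un full)
          (≤-trans (by (gap h) (ring k D (signed S))) (≤-reflexive (sym (mass-open S un))))
          where
          ring : ∀ k D s → s - + 420 * k * D ≡ + 21 * k * D + s - + 441 * k * D
          ring = solve-∀

-- Double counting of sets and elements

incidence-swap : ∀ {m n} (R : Fin m → Fin n → Bool) (ω : Fin m → ℤ) (φ : Fin n → ℤ) →
  ∑ (λ S → ω S * ∑ (λ i → ι (R S i) * φ i)) ≡ ∑ (λ i → φ i * ∑ (λ S → ι (R S i) * ω S))
incidence-swap R ω φ = begin
  ∑ (λ S → ω S * ∑ (λ i → ι (R S i) * φ i))   ≡⟨ ∑-cong (λ S → ∑-* (ω S) (λ i → ι (R S i) * φ i)) ⟨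
  ∑ (λ S → ∑ (λ i → ω S * (ι (R S i) * φ i))) ≡⟨ ∑-swap (λ S i → ω S * (ι (R S i) * φ i)) ⟩
  ∑ (λ i → ∑ (λ S → ω S * (ι (R S i) * φ i))) ≡⟨ ∑-cong (λ i → trans (∑-cong λ S → ring (ω S) (ι (R S i)) (φ i)) (∑-* (φ i) (λ S → ι (R S i) * ω S))) ⟩
  ∑ (λ i → φ i * ∑ (λ S → ι (R S i) * ω S))   ∎
  where
  open ≡-Reasoning
  ring : ∀ w r p → w * (r * p) ≡ p * (r * w)
  ring = solve-∀

ι-scale-≤ : ∀ b {x y} → (b ≡ true → x ≤ y) → ι b * x ≤ ι b * y
ι-scale-≤ true  {x} {y} x≤y = ≤-trans (≤-reflexive (*-identityˡ x)) (≤-trans (x≤y refl) (≤-reflexive (sym (*-identityˡ y))))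
ι-scale-≤ false {x} {y} _   = ≤-reflexive (trans (*-zeroˡ x) (sym (*-zeroˡ y)))

ι-covered : ∀ x g o → (g ≡ true → x ≡ true) → ι g * (1ℤ - ι o) + ι x * ι o ≤ ι x
ι-covered true  true  true  _ = ≤-refl
ι-covered true  true  false _ = ≤-refl
ι-covered true  false true  _ = ≤-refl
ι-covered true  false false _ = nat 1
ι-covered false false true  _ = ≤-refl
ι-covered false false false _ = ≤-refl
ι-covered false true  _     s = ⊥-elim (false≢true (s refl))

module Counting (m n : ℕ) (A : Fin m → Fin n → Bool) (d k : ℤ)
  (1≤k : 1ℤ ≤ k) (k≤d : + 466201 * k ≤ d) (degree≤ : ∀ i → ∑ (λ S → ι (A S i)) ≤ d)
  (D : ℤ) (a : Fin n → ℤ) (G : Fin m → Fin n → Bool) where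

  open Bundles m n A d k 1≤k
  open Linked D a G

  centre : Fin n → Bool
  centre i = floating i ∧ does (+ 46200 * k ≤? members i)

  module _ (inv : Invariant) (saturated : Saturated) where

    open Invariant inv
    open Consequences inv

    private
      φ : Fin n → ℤ
      φ i = ι (floating i)

      υ uf uv ub ob : Fin m → ℤ
      υ  S = ι (isOpen (classOf S))
      uf S = ι (isFull (classOf S))
      uv S = ι (isSpare (classOf S))
      ub S = ι (isBig (classOf S))
      ob S = ι (isTight (classOf S))

      U H Uf V B X Z Y W L Ls Ta Ob : ℤ
      U  = ∑ φ
      H  = ∑ υ
      Uf = ∑ uf
      V  = ∑ uv
      B  = ∑ ub
      X  = ∑ λ S → υ S * (d - floats S)
      Z  = ∑ λ S → υ S * floats S
      Y  = ∑ λ S → uf S * mass S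
      W  = ∑ λ S → mass S * live S
      L  = ∑ live
      Ls = ∑ λ S → (1ℤ - υ S) * live S
      Ta = ∑ λ i → ι (centre i)
      Ob = ∑ ob

      module P (S : Fin m) = Pointwise D d k (floats S) (mass S) (live S) (spareness S) 0≤D 0≤k (0≤spareness S) (≤-trans (live≤links S) (links≤ S))

      H≡ : H ≡ Uf + V + B
      H≡ = trans (∑-cong λ S → P.open-split S (profile S)) (trans (∑-+ (λ S → uf S + uv S) ub) (cong (_+ B) (∑-+ uf uv)))

      X≡ : X ≡ d * H - Z
      X≡ = trans (∑-cong λ S → ring d (υ S) (floats S)) (trans (∑-linear d -1ℤ υ (λ S → υ S * floats S)) (ring′ (d * H) Z))
        where
        ring : ∀ d u f → u * (d - f) ≡ d * u + -1ℤ * (u * f)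
        ring = solve-∀
        ring′ : ∀ x y → x + -1ℤ * y ≡ x - y
        ring′ = solve-∀

      e₁ : + 2 * D * X + + 20 * k * D * B ≤ Y - + 21 * k * D * Uf + k * D * (Uf + V)
      e₁ = by (∑-nonneg-combination (- (+ 2 * D)) (- (+ 20 * k * D)) 1ℤ (- (+ 20 * k * D)) (k * D)
               (λ S → υ S * (d - floats S)) ub (λ S → uf S * mass S) uf uv (λ S → P.deficits S (profile S)))
        (ring D k X B Y Uf V)
        where
        ring : ∀ D k X B Y Uf V → - (+ 2 * D) * X + - (+ 20 * k * D) * B + 1ℤ * Y + - (+ 20 * k * D) * Uf + k * D * V
          ≡ Y - + 21 * k * D * Uf + k * D * (Uf + V) - (+ 2 * D * X + + 20 * k * D * B)
        ring = solve-∀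

      e₂ : + 3780 * k * Y ≤ W - + 21 * k * D * L + + 21 * k * D * Ls + + 21 * k * D * (+ 4200 * k * Uf)
      e₂ = by (∑-nonneg-combination (- (+ 3780 * k)) 1ℤ (- (+ 21 * k * D)) (+ 21 * k * D) (+ 21 * k * D * (+ 4200 * k))
               (λ S → uf S * mass S) (λ S → mass S * live S) live (λ S → (1ℤ - υ S) * live S) uf (λ S → P.masses S (profile S)))
        (ring D k Y W L Ls Uf)
        where
        ring : ∀ D k Y W L Ls Uf → - (+ 3780 * k) * Y + 1ℤ * W + - (+ 21 * k * D) * L + + 21 * k * D * Ls + + 21 * k * D * (+ 4200 * k) * Uf
          ≡ W - + 21 * k * D * L + + 21 * k * D * Ls + + 21 * k * D * (+ 4200 * k * Uf) - + 3780 * k * Y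
        ring = solve-∀

      L≡ : L ≡ ∑ (λ i → φ i * members i)
      L≡ = trans (∑-cong λ S → sym (*-identityˡ (live S))) (trans (incidence-swap G (λ _ → 1ℤ) φ)
        (∑-cong λ i → cong (φ i *_) (∑-cong λ S → *-identityʳ (ι (G S i)))))

      -- Exchanging the sums groups the links by their floating centres, where `shared` applies star
      -- by star.
      e₃ : W ≤ + 21 * k * D * L
      e₃ = ≤-trans (≤-reflexive (incidence-swap G mass φ))
        (≤-trans (∑-mono λ i → ι-scale-≤ (floating i) (shared i))
          (≤-reflexive (trans (∑-cong λ i → ring (φ i) (+ 21 * k * D) (members i))
            (trans (∑-* (+ 21 * k * D) (λ i → φ i * members i)) (cong (+ 21 * k * D *_) (sym L≡))))))
        where
        ring : ∀ p x y → p * (x * y) ≡ x * (p * y)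
        ring = solve-∀

      -- At a floating element, links to settled sets and incidences with unsettled sets are
      -- disjoint parts of a degree at most `d`. The former thus fit into the degree missing on the
      -- latter.
      e₄ : Ls ≤ d * U - Z
      e₄ = by (gap (∑-mono pointwise)) (trans (cong₂ _-_ (∑-* d φ) sums) (ring Ls Z (d * U)))
        where
        sums : ∑ (λ i → φ i * ∑ (λ S → ι (G S i) * (1ℤ - υ S)) + φ i * ∑ (λ S → ι (A S i) * υ S)) ≡ Ls + Z
        sums = trans (∑-+ _ _) (sym (cong₂ _+_ (incidence-swap G (λ S → 1ℤ - υ S) φ) (incidence-swap A υ φ)))
        ring : ∀ x y z → z - (x + y) ≡ z - y - x
        ring = solve-∀
        pointwise : ∀ i → φ i * ∑ (λ S → ι (G S i) * (1ℤ - υ S)) + φ i * ∑ (λ S → ι (A S i) * υ S) ≤ d * φ i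
        pointwise i = ≤-trans (≤-reflexive (sym (*-distribˡ-+ (φ i) (∑ (λ S → ι (G S i) * (1ℤ - υ S))) (∑ (λ S → ι (A S i) * υ S)))))
          (≤-trans (ι-scale-≤ (floating i) λ _ → ≤-trans (≤-reflexive (sym (∑-+ (λ S → ι (G S i) * (1ℤ - υ S)) (λ S → ι (A S i) * υ S))))
              (≤-trans (∑-mono λ S → ι-covered (A S i) (G S i) (isOpen (classOf S)) (link⇒∈ S i)) (degree≤ i)))
            (≤-reflexive (*-comm (φ i) d)))

      0≤members : ∀ i → 0ℤ ≤ members i
      0≤members i = ∑-nonneg λ S → 0≤ι (G S i)

      e₅ : + 46200 * k * Ta ≤ L
      e₅ = ≤-trans (∑-scale-≤ (+ 46200 * k) λ i → pointwise (+ 46200 * k) (members i) (floating i) (+ 46200 * k ≤? members i) (0≤members i)) (≤-reflexive (sym L≡))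
        where
        pointwise : ∀ x y b (p : Dec (x ≤ y)) → 0ℤ ≤ y → x * ι (b ∧ does p) ≤ ι b * y
        pointwise x y true  (yes p) _   = ≤-trans (≤-reflexive (*-identityʳ x)) (≤-trans p (≤-reflexive (sym (*-identityˡ y))))
        pointwise x y true  (no  _) 0≤y = ≤-trans (≤-reflexive (*-zeroʳ x)) (≤-trans 0≤y (≤-reflexive (sym (*-identityˡ y))))
        pointwise x y false _       _   = ≤-reflexive (trans (*-zeroʳ x) (sym (*-zeroˡ y)))

      e₅′ : L ≤ + 4200 * k * H + Ls
      e₅′ = ≤-trans (∑-mono λ S → P.links-shared S (profile S))
        (≤-reflexive (trans (∑-linear (+ 4200 * k) 1ℤ υ (λ S → (1ℤ - υ S) * live S)) (cong (_+_ (+ 4200 * k * H)) (*-identityˡ Ls))))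

      e₆ : + 441 * k * D * Ob ≤ Y
      e₆ = ∑-scale-≤ (+ 441 * k * D) λ S → P.tights S (profile S)

      -- Candidates are counted twice: a spare set offers at least `d − 4201k`, and by saturation a
      -- floating element has at most `46200k`.
      e₇ : (d - + 4201 * k) * V ≤ + 46200 * k * U
      e₇ = ≤-trans (∑-scale-≤ (d - + 4201 * k) λ S → P.spares S (profile S))
        (≤-trans (≤-reflexive (trans (∑-swap (λ S i → φ i * ι (candidate S i))) (∑-cong λ i → ∑-* (φ i) (λ S → ι (candidate S i)))))
          (≤-trans (∑-mono λ i → ι-scale-≤ (floating i) (saturated i))
            (≤-reflexive (trans (∑-cong λ i → *-comm (φ i) (+ 46200 * k)) (∑-* (+ 46200 * k) φ)))))

      0≤Ls : 0ℤ ≤ Ls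
      0≤Ls = ∑-nonneg λ S → pointwise (isOpen (classOf S)) ⊗ 0≤live S
        where
        pointwise : ∀ b → 0ℤ ≤ 1ℤ - ι b
        pointwise true  = ≤-refl
        pointwise false = nat 1

      held-split : ∑ (λ S → ι (isHeld (classOf S))) ≡ B + V + Ob
      held-split = trans (∑-cong λ S → pointwise (classOf S)) (trans (∑-+ (λ S → ub S + uv S) ob) (cong (_+ Ob) (∑-+ ub uv)))
        where
        pointwise : ∀ c → ι (isHeld c) ≡ ι (isBig c) + ι (isSpare c) + ι (isTight c)
        pointwise closed = refl
        pointwise big    = refl
        pointwise spare  = refl
        pointwise loose  = refl
        pointwise tight  = refl

    few-constraints : 0ℤ < ∑ (λ i → ι (floating i)) → ∑ (λ i → ι (floating i)) ≤ ∑ (λ S → ι (isOpen (classOf S))) →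
      ∑ (λ i → ι (centre i)) + ∑ (λ S → ι (isHeld (classOf S))) < ∑ (λ i → ι (floating i))
    few-constraints 0<U U≤H = subst (λ z → Ta + z < U) (sym held-split)
      (Counting-arith.count< D d k U H Uf V B X Z (d * U - Z) Y W L Ls Ta Ob 0<D 1≤k k≤d
        (∑-nonneg λ S → 0≤ι (isBig (classOf S))) (∑-nonneg λ S → 0≤ι (isSpare (classOf S))) 0≤Ls
        H≡ X≡ refl e₁ e₂ e₃ e₄ e₅ e₅′ e₆ e₇ U≤H 0<U)

∑-delta : ∀ {n} (i₀ : Fin n) x → ∑ (λ i → ι (does (i Fin.≟ i₀)) * x) ≡ x
∑-delta {ℕ.suc n} zero x = trans (∑-suc (λ i → ι (does (i Fin.≟ zero)) * x))
  (trans (cong₂ _+_ (*-identityˡ x) (∑-zero {n} λ i → *-zeroˡ x)) (+-identityʳ x))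
∑-delta {ℕ.suc n} (suc i₀) x = trans (∑-suc (λ i → ι (does (i Fin.≟ suc i₀)) * x))
  (trans (cong₂ _+_ (*-zeroˡ x) (∑-delta i₀ x)) (+-identityˡ x))

add : ∀ {P : Set} → Bool → Dec P → Bool → Bool
add g (yes _) c = g ∨ c
add g (no  _) _ = g

ι-add-≤ : ∀ {P : Set} g (p : Dec P) c → ι (add g p c) ≤ ι g + ι (does p) * ι c
ι-add-≤ true  (yes _) true  = +≤+ (ℕ.s≤s ℕ.z≤n)
ι-add-≤ true  (yes _) false = ≤-refl
ι-add-≤ false (yes _) true  = ≤-refl
ι-add-≤ false (yes _) false = ≤-refl
ι-add-≤ true  (no  _) true  = ≤-refl
ι-add-≤ true  (no  _) false = ≤-refl
ι-add-≤ false (no  _) true  = ≤-refl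
ι-add-≤ false (no  _) false = ≤-refl

ι-≤-add : ∀ {P : Set} g (p : Dec P) c → ι g ≤ ι (add g p c)
ι-≤-add true  (yes _) c     = ≤-refl
ι-≤-add false (yes _) true  = nat 1
ι-≤-add false (yes _) false = ≤-refl
ι-≤-add true  (no  _) _     = ≤-refl
ι-≤-add false (no  _) _     = ≤-refl

ι-add-yes : ∀ g s x → ι (g ∨ (s ∧ (x ∧ not g))) ≡ ι g + ι (s ∧ (x ∧ not g))
ι-add-yes true  true  true  = refl
ι-add-yes true  true  false = refl
ι-add-yes true  false true  = refl
ι-add-yes true  false false = refl
ι-add-yes false true  true  = refl
ι-add-yes false true  false = refl
ι-add-yes false false true  = refl
ι-add-yes false false false = refl

add-true : ∀ {P : Set} g (p : Dec P) s x → add g p (s ∧ (x ∧ not g)) ≡ true → g ≡ true ⊎ (P × x ≡ true)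
add-true true  _       _     _     _ = inj₁ refl
add-true false (yes p) true  true  _ = inj₂ (p , refl)

∧-fst : ∀ {x y} → x ∧ y ≡ true → x ≡ true
∧-fst {true} _ = refl

isSpare-true : ∀ {c} → isSpare c ≡ true → c ≡ spare
isSpare-true {spare} _ = refl

fuel-step : ∀ r b x y → b ≤ + ℕ.suc r + x → x < y → b ≤ + r + y
fuel-step r b x y close more = by (gap (subst (λ z → b ≤ z + x) (pos-+ 1 r) close) ⊕ gap< more) (ring (+ r) b x y)
  where
  ring : ∀ r b x y → (1ℤ + r + x - b) + (y - x - 1ℤ) ≡ r + y - b
  ring = solve-∀

-- Forming stars

module Saturation (m n : ℕ) (A : Fin m → Fin n → Bool) (d k : ℤ)
  (1≤k : 1ℤ ≤ k)
  (D : ℤ) (a : Fin n → ℤ) where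

  open Bundles m n A d k 1≤k

  module Enlarge (G : Fin m → Fin n → Bool) (inv : Linked.Invariant D a G)
    (i₀ : Fin n) (float₀ : Colour.floating D a i₀ ≡ true) (many : + 46200 * k < Linked.candidates D a G i₀) where

    open Linked D a G
    open Invariant inv
    open Consequences inv

    -- All candidates at `i₀` are linked at once, so that the star there is of full size
    -- immediately.
    G′ : Fin m → Fin n → Bool
    G′ S i = add (G S i) (i Fin.≟ i₀) (candidate S i)

    module L′ = Linked D a G′

    candidate⇒spare : ∀ S i → candidate S i ≡ true → ClassView S spare
    candidate⇒spare S i eq = subst (ClassView S) (isSpare-true (∧-fst eq)) (classView S)

    -- A candidate is unsettled and not fully linked, hence has sum 0. Its mass is exactly the
    -- average that `shared` allows, so new members preserve that bound.
    candidate-mass : ∀ S i → ι (candidate S i) * mass S ≡ + 21 * k * D * ι (candidate S i)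
    candidate-mass S i = go (candidate S i) (candidate⇒spare S i)
      where
      go : ∀ c → (c ≡ true → ClassView S spare) → ι c * mass S ≡ + 21 * k * D * ι c
      go false _ = trans (*-zeroˡ (mass S)) (sym (*-zeroʳ (+ 21 * k * D)))
      go true  v = balance (v refl)
        where
        balance : ClassView S spare → 1ℤ * mass S ≡ + 21 * k * D * 1ℤ
        balance (spare un few _) = trans (*-identityˡ (mass S)) (trans (mass-balanced S un few) (sym (*-identityʳ (+ 21 * k * D))))

    links≤links′ : ∀ S → links S ≤ L′.links S
    links≤links′ S = ∑-mono λ i → ι-≤-add (G S i) (i Fin.≟ i₀) (candidate S i)

    links′≤links+1 : ∀ S → L′.links S ≤ links S + ι (candidate S i₀)
    links′≤links+1 S = ≤-trans (∑-mono λ i → ≤-trans (ι-add-≤ (G S i) (i Fin.≟ i₀) (candidate S i)) (≤-reflexive (cong (_+_ (ι (G S i))) (here i (i Fin.≟ i₀)))))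
      (≤-reflexive (trans (∑-+ (λ i → ι (G S i)) (λ i → ι (does (i Fin.≟ i₀)) * ι (candidate S i₀))) (cong (_+_ (links S)) (∑-delta i₀ (ι (candidate S i₀))))))
      where
      here : ∀ i (p : Dec (i ≡ i₀)) → ι (does p) * ι (candidate S i) ≡ ι (does p) * ι (candidate S i₀)
      here i (yes refl) = refl
      here i (no  _)    = trans (*-zeroˡ (ι (candidate S i))) (sym (*-zeroˡ (ι (candidate S i₀))))

    -- All new links go to `i₀`, which floats and is counted already.
    span′≤span : ∀ S → L′.span S ≤ span S
    span′≤span S = ∑-mono λ i → pointwise (ι (A S i)) (0≤ι (A S i)) i (i Fin.≟ i₀)
      where
      union : ∀ f g c → f ≡ true → ι (f ∨ (g ∨ c)) ≤ ι (f ∨ g)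
      union true _ _ _ = ≤-refl
      pointwise : ∀ x → 0ℤ ≤ x → ∀ i (p : Dec (i ≡ i₀)) → x * ι (floating i ∨ add (G S i) p (candidate S i)) ≤ x * ι (floating i ∨ G S i)
      pointwise x 0≤x i (no  _)    = ≤-refl
      pointwise x 0≤x i (yes refl) = *-monoˡ-≤-nonNeg x {{nonNegative 0≤x}} (union (floating i) (G S i) (candidate S i) float₀)

    span-unlinked : ∀ S → links S ≤ 0ℤ → span S ≤ floats S
    span-unlinked S none = ≤-trans (≤-reflexive (span-split link⇒∈ S)) (by (gap none ⊕ 0≤live S) (ring (floats S) (links S) (live S)))
      where
      ring : ∀ f l v → 0ℤ - l + v ≡ f - (f + l - v)
      ring = solve-∀

    members-here : L′.members i₀ ≡ members i₀ + candidates i₀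
    members-here = trans (∑-cong λ S → pointwise S (i₀ Fin.≟ i₀)) (∑-+ (λ S → ι (G S i₀)) (λ S → ι (candidate S i₀)))
      where
      pointwise : ∀ S (p : Dec (i₀ ≡ i₀)) → ι (add (G S i₀) p (candidate S i₀)) ≡ ι (G S i₀) + ι (candidate S i₀)
      pointwise S (yes _) = ι-add-yes (G S i₀) (isSpare (classOf S)) (A S i₀)
      pointwise S (no  p) = ⊥-elim (p refl)

    G′-elsewhere : ∀ S i → i ≢ i₀ → G′ S i ≡ G S i
    G′-elsewhere S i i≢i₀ = go (i Fin.≟ i₀)
      where
      go : (p : Dec (i ≡ i₀)) → add (G S i) p (candidate S i) ≡ G S i
      go (yes i≡i₀) = ⊥-elim (i≢i₀ i≡i₀)
      go (no  _)    = refl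

    members-elsewhere : ∀ i → i ≢ i₀ → L′.members i ≡ members i
    members-elsewhere i i≢i₀ = ∑-cong λ S → cong ι (G′-elsewhere S i i≢i₀)

    0≤members : ∀ i → 0ℤ ≤ members i
    0≤members i = ∑-nonneg λ S → 0≤ι (G S i)

    shared-here : ∑ (λ S → ι (G′ S i₀) * mass S) ≤ + 21 * k * D * L′.members i₀
    shared-here = ≤-trans (≤-reflexive (trans (∑-cong λ S → pointwise S (i₀ Fin.≟ i₀)) (∑-+ (λ S → ι (G S i₀) * mass S) (λ S → + 21 * k * D * ι (candidate S i₀)))))
      (≤-trans (+-mono-≤ (shared i₀ float₀) (≤-reflexive (∑-* (+ 21 * k * D) (λ S → ι (candidate S i₀)))))
        (≤-reflexive (trans (sym (*-distribˡ-+ (+ 21 * k * D) (members i₀) (candidates i₀))) (cong (+ 21 * k * D *_) (sym members-here)))))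
      where
      pointwise : ∀ S (p : Dec (i₀ ≡ i₀)) → ι (add (G S i₀) p (candidate S i₀)) * mass S ≡ ι (G S i₀) * mass S + + 21 * k * D * ι (candidate S i₀)
      pointwise S (yes _) = trans (cong (_* mass S) (ι-add-yes (G S i₀) (isSpare (classOf S)) (A S i₀)))
        (trans (*-distribʳ-+ (mass S) (ι (G S i₀)) (ι (candidate S i₀))) (cong (_+_ (ι (G S i₀) * mass S)) (candidate-mass S i₀)))
      pointwise S (no  p) = ⊥-elim (p refl)

    inv′ : L′.Invariant
    inv′ = record
      { 0<D = 0<D
      ; bounded = bounded
      ; link⇒∈ = λ S i eq → [ link⇒∈ S i , proj₂ ]′ (add-true (G S i) (i Fin.≟ i₀) (isSpare (classOf S)) (A S i) eq)
      ; links≤ = links≤′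
      ; span≤ = span≤′
      ; balanced = λ S un few → balanced S un (≤-<-trans (links≤links′ S) few)
      ; tame = tame
      ; shared = λ i fl → shared′ i fl (i Fin.≟ i₀)
      ; crowded = λ i fl → crowded′ i fl (i Fin.≟ i₀)
      }
      where
      links≤′ : ∀ S → L′.links S ≤ + 4200 * k
      links≤′ S = go (candidate S i₀) (candidate⇒spare S i₀) (links′≤links+1 S)
        where
        go : ∀ c → (c ≡ true → ClassView S spare) → L′.links S ≤ links S + ι c → L′.links S ≤ + 4200 * k
        go false _ le = ≤-trans le (≤-trans (≤-reflexive (+-identityʳ (links S))) (links≤ S))
        go true  v le = room (v refl)
          where
          room : ClassView S spare → L′.links S ≤ + 4200 * k
          room (spare _ few _) = ≤-trans le (≤-trans (≤-reflexive (+-comm (links S) 1ℤ)) (i<j⇒suc[i]≤j few))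

      span≤′ : ∀ S → 0ℤ < L′.links S → L′.span S ≤ d + + 10 * k
      span≤′ S linked′ = decide (0ℤ <? links S)
        where
        go : links S ≤ 0ℤ → ∀ c → (c ≡ true → ClassView S spare) → L′.links S ≤ links S + ι c → L′.span S ≤ d + + 10 * k
        go none false _ le = ⊥-elim (<-irrefl refl (<-≤-trans linked′ (≤-trans le (≤-trans (≤-reflexive (+-identityʳ (links S))) none))))
        go none true  v _  = small (v refl)
          where
          small : ClassView S spare → L′.span S ≤ d + + 10 * k
          small (spare _ _ small) = ≤-trans (span′≤span S) (≤-trans (span-unlinked S none) small)

        decide : Dec (0ℤ < links S) → L′.span S ≤ d + + 10 * k
        decide (yes linked) = ≤-trans (span′≤span S) (span≤ S linked)
        decide (no  none)   = go (≮⇒≥ none) (candidate S i₀) (candidate⇒spare S i₀) (links′≤links+1 S)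

      shared′ : ∀ i → floating i ≡ true → Dec (i ≡ i₀) → ∑ (λ S → ι (G′ S i) * mass S) ≤ + 21 * k * D * L′.members i
      shared′ i fl (yes refl) = shared-here
      shared′ i fl (no  i≢i₀) = ≤-trans (≤-reflexive (∑-cong λ S → cong (λ g → ι g * mass S) (G′-elsewhere S i i≢i₀)))
        (≤-trans (shared i fl) (≤-reflexive (cong (+ 21 * k * D *_) (sym (members-elsewhere i i≢i₀)))))

      crowded′ : ∀ i → floating i ≡ true → Dec (i ≡ i₀) → L′.members i ≡ 0ℤ ⊎ + 46200 * k ≤ L′.members i
      crowded′ i fl (yes refl) = inj₂ (≤-trans (<⇒≤ many) (≤-trans (≤-trans (≤-reflexive (sym (+-identityˡ (candidates i)))) (+-monoˡ-≤ (candidates i) (0≤members i)))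
        (≤-reflexive (sym members-here))))
      crowded′ i fl (no  i≢i₀) = subst (λ z → z ≡ 0ℤ ⊎ + 46200 * k ≤ z) (sym (members-elsewhere i i≢i₀)) (crowded i fl)

    more-links : ∑ members < ∑ L′.members
    more-links = ∑-strict (λ i → ∑-mono λ S → ι-≤-add (G S i) (i Fin.≟ i₀) (candidate S i)) i₀
      (<-≤-trans (≤-<-trans (≤-reflexive (sym (+-identityʳ (members i₀)))) (+-monoʳ-< (members i₀) (≤-<-trans (nat 46200 ⊗ 0≤k) many))) (≤-reflexive (sym members-here)))

  total-links≤ : ∀ G → Linked.Invariant D a G → ∑ (Linked.members D a G) ≤ ∑ {m} (λ _ → + 4200 * k)
  total-links≤ G inv = ≤-trans (≤-reflexive (∑-swap (λ i S → ι (G S i)))) (∑-mono (Linked.Invariant.links≤ inv))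

  -- Every enlargement adds links, of which a set never has more than `4200k`; `r` bounds how many
  -- can still be added.
  saturate : ∀ r G → Linked.Invariant D a G → ∑ {m} (λ _ → + 4200 * k) ≤ + r + ∑ (Linked.members D a G) →
    ∃[ G′ ] (Linked.Invariant D a G′ × Linked.Saturated D a G′)
  saturate r G inv close = go (Fin.any? λ i → (Colour.floating D a i Bool.≟ true) ×-dec (+ 46200 * k <? Linked.candidates D a G i)) r close
    where
    go : Dec (∃[ i ] (Colour.floating D a i ≡ true × + 46200 * k < Linked.candidates D a G i)) →
      ∀ r → ∑ {m} (λ _ → + 4200 * k) ≤ + r + ∑ (Linked.members D a G) → ∃[ G′ ] (Linked.Invariant D a G′ × Linked.Saturated D a G′)
    go (no none) _ _ = G , inv , λ i fl → ≮⇒≥ λ lt → none (i , fl , lt)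
    go (yes (i₀ , float₀ , many)) ℕ.zero close = ⊥-elim (<-irrefl refl (<-≤-trans E.more-links (≤-trans (total-links≤ E.G′ E.inv′)
        (≤-trans close (≤-reflexive (+-identityˡ (∑ (Linked.members D a G))))))))
      where module E = Enlarge G inv i₀ float₀ many
    go (yes (i₀ , float₀ , many)) (ℕ.suc r) close = saturate r E.G′ E.inv′
        (fuel-step r (∑ {m} (λ _ → + 4200 * k)) (∑ (Linked.members D a G)) (∑ (Linked.members D a E.G′)) close E.more-links)
      where module E = Enlarge G inv i₀ float₀ many

-- Moving the colouring

same-kind : ∀ {T u v u′ v′ κ κ′} → KindView T u v κ → KindView T u′ v′ κ′ → u′ ≤ u → v′ ≤ v → ¬ (T < u × T < v) → κ′ ≢ settled → κ′ ≡ κ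
same-kind (over _)      (over _)       _    _    _     _  = refl
same-kind (under u≤ _)  (over T<u′)    u′≤u _    _     _  = ⊥-elim (<-irrefl refl (<-≤-trans T<u′ (≤-trans u′≤u u≤)))
same-kind (settled u≤ _) (over T<u′)   u′≤u _    _     _  = ⊥-elim (<-irrefl refl (<-≤-trans T<u′ (≤-trans u′≤u u≤)))
same-kind (over T<u)    (under _ T<v′) _    v′≤v clash _  = ⊥-elim (clash (T<u , <-≤-trans T<v′ v′≤v))
same-kind (under _ _)   (under _ _)    _    _    _     _  = refl
same-kind (settled _ v≤) (under _ T<v′) _   v′≤v _     _  = ⊥-elim (<-irrefl refl (<-≤-trans T<v′ (≤-trans v′≤v v≤)))
same-kind _             (settled _ _)  _    _    _     un = ⊥-elim (un refl)

stays-settled : ∀ {T u v u′ v′ κ κ′} → KindView T u v κ → KindView T u′ v′ κ′ → u′ ≤ u → v′ ≤ v → κ ≡ settled → κ′ ≡ settled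
stays-settled (settled u≤ v≤) (over T<u′)    u′≤u _    _ = ⊥-elim (<-irrefl refl (<-≤-trans T<u′ (≤-trans u′≤u u≤)))
stays-settled (settled u≤ v≤) (under _ T<v′) _    v′≤v _ = ⊥-elim (<-irrefl refl (<-≤-trans T<v′ (≤-trans v′≤v v≤)))
stays-settled _               (settled _ _)  _    _    _ = refl

Frozen : Status → Status → Set
Frozen s s′ = s′ ≡ s ⊎ s ≡ float

hi-mono : ∀ {s s′} → Frozen s s′ → hi s′ ≤ hi s
hi-mono (inj₁ refl) = ≤-refl
hi-mono {s′ = top}   (inj₂ refl) = ≤-refl
hi-mono {s′ = bot}   (inj₂ refl) = -≤+
hi-mono {s′ = float} (inj₂ refl) = ≤-refl

lo-mono : ∀ {s s′} → Frozen s s′ → lo s′ ≤ lo s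
lo-mono (inj₁ refl) = ≤-refl
lo-mono {s′ = top}   (inj₂ refl) = -≤+
lo-mono {s′ = bot}   (inj₂ refl) = ≤-refl
lo-mono {s′ = float} (inj₂ refl) = ≤-refl

float-back : ∀ {s s′} → Frozen s s′ → isFloat s′ ≡ true → isFloat s ≡ true
float-back (inj₁ refl) fl = fl
float-back (inj₂ refl) _  = refl

ι-mono : ∀ {b c} → (b ≡ true → c ≡ true) → ι b ≤ ι c
ι-mono {true}  {true}  _ = ≤-refl
ι-mono {true}  {false} f = ⊥-elim (false≢true (f refl))
ι-mono {false} {true}  _ = nat 1
ι-mono {false} {false} _ = ≤-refl

∨-mono : ∀ {b c} g → (b ≡ true → c ≡ true) → b ∨ g ≡ true → c ∨ g ≡ true
∨-mono {true}  {c}     g f _  = subst (λ z → z ∨ g ≡ true) (sym (f refl)) refl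
∨-mono {false} {true}  g f _  = refl
∨-mono {false} {false} g f eq = eq

isPending : ∀ {P Q : Set} → Dec P → Dec Q → Bool
isPending (yes _) _       = false
isPending (no  _) (yes _) = true
isPending (no  _) (no  _) = false

pending-true : ∀ {P Q : Set} (p : Dec P) (q : Dec Q) → isPending p q ≡ true → ¬ P × Q
pending-true (no p) (yes q) _ = p , q

true-pending : ∀ {P Q : Set} (p : Dec P) (q : Dec Q) → ¬ P → Q → isPending p q ≡ true
true-pending (yes p) _       ¬p _ = ⊥-elim (¬p p)
true-pending (no  _) (yes _) _  _ = refl
true-pending (no  _) (no ¬q) _  q = ⊥-elim (¬q q)

-- Two extremes beyond `2d − k` would add up to more than `4d − 2k`, but their sum is at most
-- `2d + 20k`. Therefore a small set cannot switch sides while its extremes shrink.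
both-arith : ∀ d k h l f → 0ℤ ≤ k → + 466201 * k ≤ d → h + l ≡ + 2 * f → f ≤ d + + 10 * k → ¬ ((+ 2 * d - k < h) × (+ 2 * d - k < l))
both-arith d k h l f 0≤k k≤d h+l small (T<h , T<l) = <-irrefl refl (<-≤-trans (+<+ (ℕ.s≤s ℕ.z≤n)) 1≤0)
  where
  ring : ∀ d k h l f → (h - (+ 2 * d - k) - 1ℤ) + (l - (+ 2 * d - k) - 1ℤ) + + 2 * (d + + 10 * k - f) + + 2 * (d - + 466201 * k) + + 932380 * k ≡ (h + l) - + 2 * f - + 2
  ring = solve-∀
  ring′ : ∀ f → + 2 * f - + 2 * f - + 2 ≡ 0ℤ - + 2
  ring′ = solve-∀
  1≤0 : + 2 ≤ 0ℤ
  1≤0 = by (gap< T<h ⊕ gap< T<l ⊕ nat 2 ⊗ gap small ⊕ nat 2 ⊗ gap k≤d ⊕ nat 932380 ⊗ 0≤k)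
    (trans (ring d k h l f) (trans (cong (λ z → z - + 2 * f - + 2) h+l) (ring′ f)))

data Obstacle (m n : ℕ) : Set where
  ceiling floor : Fin n → Obstacle m n
  load          : Fin m → Obstacle m n

obstacles : ∀ m n → List (Obstacle m n)
obstacles m n = map ceiling (allFin n) ++ (map floor (allFin n) ++ map load (allFin m))

∈-obstacles : ∀ {m n} (o : Obstacle m n) → o ∈ obstacles m n
∈-obstacles {m} {n} (ceiling i) = ∈-++⁺ˡ (∈-map⁺ ceiling (∈-allFin i))
∈-obstacles {m} {n} (floor i)   = ∈-++⁺ʳ (map ceiling (allFin n)) (∈-++⁺ˡ (∈-map⁺ floor (∈-allFin i)))
∈-obstacles {m} {n} (load S)    = ∈-++⁺ʳ (map ceiling (allFin n)) (∈-++⁺ʳ (map floor (allFin n)) (∈-map⁺ load (∈-allFin S)))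

pos-or-neg : ∀ {y} → y ≢ 0ℤ → 0ℤ < y ⊎ 0ℤ < - y
pos-or-neg {+0}       y≢0 = ⊥-elim (y≢0 refl)
pos-or-neg {+[1+ _ ]} _   = inj₁ (+<+ (ℕ.s≤s ℕ.z≤n))
pos-or-neg { -[1+ _ ]} _  = inj₂ (+<+ (ℕ.s≤s ℕ.z≤n))

drop : ∀ b c → b ≡ false → c ≡ true → ι b < ι c
drop false true _ _ = +<+ (ℕ.s≤s ℕ.z≤n)

module Measure (m n : ℕ) (A : Fin m → Fin n → Bool) (d k : ℤ) where

  open System m n A d k

  pending : ℤ → (Fin n → ℤ) → Fin m → Bool
  pending D a S = isPending (settled? (kindOf S)) (signed S <? + 420 * k * D)
    where open Colour D a

  -- A set is pending until it settles or gets off by `420k`. Every move freezes an element or ends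
  -- a pending state, and neither is undone.
  measure : ℤ → (Fin n → ℤ) → ℤ
  measure D a = ∑ (λ i → ι (Colour.floating D a i)) + ∑ (λ S → ι (pending D a S))

module Move (m n : ℕ) (A : Fin m → Fin n → Bool) (d k : ℤ)
  (1≤k : 1ℤ ≤ k) (k≤d : + 466201 * k ≤ d)
  (D : ℤ) (a : Fin n → ℤ) (G : Fin m → Fin n → Bool) (inv : Bundles.Linked.Invariant m n A d k 1≤k D a G) where

  open Bundles m n A d k 1≤k
  open Linked D a G
  open Invariant inv
  open Consequences inv
  open Measure m n A d k

  0<420kD : 0ℤ < + 420 * k * D
  0<420kD = <-≤-trans 0<D (by (gap 1≤k ⊗ 0≤D ⊕ nat 419 ⊗ 0≤k ⊗ 0≤D) (ring k D))
    where
    ring : ∀ k D → (k - 1ℤ) * D + + 419 * k * D ≡ + 420 * k * D - D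
    ring = solve-∀

  open-cases : ∀ S → kindOf S ≢ settled → (+ 4200 * k ≤ links S × signed S < + 420 * k * D) ⊎ isHeld (classOf S) ≡ true
  open-cases S un = go (classOf S) (classView S)
    where
    go : ∀ c → ClassView S c → (+ 4200 * k ≤ links S × signed S < + 420 * k * D) ⊎ isHeld c ≡ true
    go _ (closed eq)        = ⊥-elim (un eq)
    go _ (big _ _ _)        = inj₂ refl
    go _ (spare _ _ _)      = inj₂ refl
    go _ (loose _ full lt)  = inj₁ (full , lt)
    go _ (tight _ _ _)      = inj₂ refl

  -- One moves from a along y until a colour reaches ±1 or a fully linked set gets off by 420k.
  module Along (y : Fin n → ℤ)
    (still : ∀ i → floating i ≡ false → y i ≡ 0ℤ)
    (held : ∀ S → isHeld (classOf S) ≡ true → weight S y ≡ 0ℤ)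
    (centred : ∀ i → floating i ≡ true → ∑ (λ S → ι (G S i) * (orientation (kindOf S) * weight S y)) ≡ 0ℤ) where

    w drift : Fin m → ℤ
    w S = weight S y
    drift S = orientation (kindOf S) * w S

    slack speed : Obstacle m n → ℤ
    slack (ceiling i) = D - a i
    slack (floor i)   = a i - - D
    -- The indicator gives settled sets slack 0, in accordance with their speed 0; `tame` bounds the
    -- sums of unsettled sets only.
    slack (load S)    = ι (unsettled (kindOf S)) * (+ 420 * k * D - signed S)
    speed (ceiling i) = y i
    speed (floor i)   = - y i
    speed (load S)    = drift S

    0≤slack : ∀ o → 0ℤ ≤ slack o
    0≤slack (ceiling i) = gap (proj₂ (bounded i))
    0≤slack (floor i)   = gap (proj₁ (bounded i))
    0≤slack (load S)    = decide (settled? (kindOf S))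
      where
      decide : Dec (kindOf S ≡ settled) → 0ℤ ≤ ι (unsettled (kindOf S)) * (+ 420 * k * D - signed S)
      decide (no  un) = 0≤ι (unsettled (kindOf S)) ⊗ gap (tame S un)
      decide (yes eq) = ≤-reflexive (sym (trans (cong (λ κ → ι (unsettled κ) * (+ 420 * k * D - signed S)) eq) (*-zeroˡ (+ 420 * k * D - signed S))))

    module Hit (h : Obstacle m n) (0<r : 0ℤ < speed h) (first : ∀ o → slack h * speed o ≤ slack o * speed h) where

      -- The move lasts for time `p / r`. Scaling colours and denominator by `r` keeps them
      -- integral: `a′ / D′` equals `(a + (p / r) y) / D`.
      r p D′ : ℤ
      r  = speed h
      p  = slack h
      D′ = r * D

      a′ : Fin n → ℤ
      a′ i = r * a i + p * y i

      0≤r : 0ℤ ≤ r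
      0≤r = <⇒≤ 0<r

      0<D′ : 0ℤ < D′
      0<D′ = subst (_< r * D) (*-zeroʳ r) (*-monoˡ-<-pos r {{positive 0<r}} 0<D)

      module C′ = Colour D′ a′

      bounded′ : C′.Bounded
      bounded′ i = by (gap (first (floor i))) (ring₁ (a i) r D p (y i)) , by (gap (first (ceiling i))) (ring₂ (a i) r D p (y i))
        where
        ring₁ : ∀ a r D p y → (a - - D) * r - p * - y ≡ r * a + p * y - - (r * D)
        ring₁ = solve-∀
        ring₂ : ∀ a r D p y → (D - a) * r - p * y ≡ r * D - (r * a + p * y)
        ring₂ = solve-∀

      module V′ = C′.Valid 0<D′ bounded′

      frozen : ∀ i → Frozen (st i) (C′.st i)
      frozen i = go (st i) (status-view D (a i)) (still i)
        where
        stuck : ∀ {x} → y i ≡ 0ℤ → a i ≡ x → a′ i ≡ r * x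
        stuck {x} y≡0 a≡x = trans (cong₂ (λ u v → r * u + p * v) a≡x y≡0) (ring r x p)
          where
          ring : ∀ r x p → r * x + p * 0ℤ ≡ r * x
          ring = solve-∀
        go : ∀ s → StatusView D (a i) s → (isFloat s ≡ false → y i ≡ 0ℤ) → Frozen s (C′.st i)
        go _ (top eq)    f = inj₁ (status-top (stuck (f refl) eq))
        go _ (bot eq)    f = inj₁ (status-bot 0<D′ (trans (stuck (f refl) eq) (sym (neg-distribʳ-* r D))))
        go _ (float _ _) _ = inj₂ refl

      floating-back : ∀ i → C′.floating i ≡ true → floating i ≡ true
      floating-back i = float-back (frozen i)

      highest-≤ : ∀ S → C′.highest S ≤ highest S
      highest-≤ S = weight-mono S λ i → hi-mono (frozen i)

      lowest-≤ : ∀ S → C′.lowest S ≤ lowest S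
      lowest-≤ S = weight-mono S λ i → lo-mono (frozen i)

      value′ : ∀ S → C′.value S ≡ r * value S + p * w S
      value′ S = weight-linear S r p a y

      view : ∀ S → KindView (+ 2 * d - k) (highest S) (lowest S) (kindOf S)
      view S = kind-view (+ 2 * d - k) (highest S) (lowest S)

      view′ : ∀ S → KindView (+ 2 * d - k) (C′.highest S) (C′.lowest S) (C′.kindOf S)
      view′ S = kind-view (+ 2 * d - k) (C′.highest S) (C′.lowest S)

      unsettled-back : ∀ S → C′.kindOf S ≢ settled → kindOf S ≢ settled
      unsettled-back S un′ eq = un′ (stays-settled (view S) (view′ S) (highest-≤ S) (lowest-≤ S) eq)

      kind-same : ∀ S → Small S → C′.kindOf S ≢ settled → C′.kindOf S ≡ kindOf S
      kind-same S small = same-kind (view S) (view′ S) (highest-≤ S) (lowest-≤ S)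
        (both-arith d k (highest S) (lowest S) (floats S) 0≤k k≤d (highest+lowest S) small)

      signed′ : ∀ S → Small S → C′.kindOf S ≢ settled → C′.signed S ≡ r * signed S + p * drift S
      signed′ S small un′ = trans (cong₂ (λ κ v → orientation κ * v) (kind-same S small un′) (value′ S))
        (ring (orientation (kindOf S)) r p (value S) (w S))
        where
        ring : ∀ o r p v w → o * (r * v + p * w) ≡ r * (o * v) + p * (o * w)
        ring = solve-∀

      balanced′ : ∀ S → C′.kindOf S ≢ settled → links S < + 4200 * k → C′.value S ≡ 0ℤ
      balanced′ S un′ few = trans (value′ S) (trans (cong₂ (λ u v → r * u + p * v) (balanced S un few)
          ([ (λ (full , _) → ⊥-elim (<-irrefl refl (<-≤-trans few full))) , held S ]′ (open-cases S un))) (ring r p))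
        where
        un = unsettled-back S un′
        ring : ∀ r p → r * 0ℤ + p * 0ℤ ≡ 0ℤ
        ring = solve-∀

      0≤420 : 0ℤ ≤ + 420 * k * D′
      0≤420 = nat 420 ⊗ 0≤k ⊗ <⇒≤ 0<D′

      -- For fully linked sets the move ends before the bound is passed, as `load S` is an obstacle;
      -- the other unsettled sets keep the sum 0.
      tame′ : ∀ S → C′.kindOf S ≢ settled → C′.signed S ≤ + 420 * k * D′
      tame′ S un′ = decide (links S <? + 4200 * k)
        where
        un = unsettled-back S un′
        decide : Dec (links S < + 4200 * k) → C′.signed S ≤ + 420 * k * D′
        decide (yes few) = ≤-trans (≤-reflexive (trans (cong (orientation (C′.kindOf S) *_) (balanced′ S un′ few)) (*-zeroʳ (orientation (C′.kindOf S))))) 0≤420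
        decide (no ¬few) = ≤-trans (≤-reflexive (signed′ S (full⇒small S (≮⇒≥ ¬few)) un′))
          (by (gap (first (load S))) (trans (cong (λ z → z * (+ 420 * k * D - signed S) * r - p * drift S) (unsettled≡1 un))
            (ring (+ 420 * k) D (signed S) r p (drift S))))
          where
          ring : ∀ c D s r p w → 1ℤ * (c * D - s) * r - p * w ≡ c * (r * D) - (r * s + p * w)
          ring = solve-∀

      -- The star equation cancels the drifts of the members, so their total mass is just scaled by
      -- `r`, apart from members that settle.
      shared′ : ∀ i → C′.floating i ≡ true → ∑ (λ S → ι (G S i) * C′.mass S) ≤ + 21 * k * D′ * members i
      shared′ i fl′ = ≤-trans (∑-mono λ S → ι-scale-≤ (G S i) (lighter S))
          (≤-trans (≤-reflexive (trans (∑-cong λ S → ring (ι (G S i)) (ι (unsettled (kindOf S))) k D r p (orientation (kindOf S)) (value S) (w S))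
              (∑-linear r p (λ S → ι (G S i) * mass S) (λ S → ι (G S i) * drift S))))
            (≤-trans (≤-reflexive (trans (cong (λ z → r * ∑ (λ S → ι (G S i) * mass S) + p * z) (centred i fl)) (ring₀ (r * ∑ (λ S → ι (G S i) * mass S)) p)))
              (≤-trans (*-monoˡ-≤-nonNeg r {{nonNegative 0≤r}} (shared i fl)) (≤-reflexive (ring₁ r k D (members i))))))
        where
        fl = floating-back i fl′
        ring : ∀ g u k D r p o v w → g * (u * (+ 21 * k * (r * D)) + o * (r * v + p * w)) ≡ r * (g * (u * (+ 21 * k * D) + o * v)) + p * (g * (o * w))
        ring = solve-∀
        ring₀ : ∀ x p → x + p * 0ℤ ≡ x
        ring₀ = solve-∀
        ring₁ : ∀ r k D x → r * (+ 21 * k * D * x) ≡ + 21 * k * (r * D) * x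
        ring₁ = solve-∀

        lighter : ∀ S → G S i ≡ true → C′.mass S ≤ ι (unsettled (kindOf S)) * (+ 21 * k * D′) + orientation (kindOf S) * (r * value S + p * w S)
        lighter S g = decide (settled? (C′.kindOf S)) (settled? (kindOf S))
          where
          small : Small S
          small = linked⇒small S (<-≤-trans (+<+ (ℕ.s≤s ℕ.z≤n)) (≤-trans (≤-reflexive (cong ι (sym g))) (∑-member (λ j → 0≤ι (G S j)) i)))
          rhs : Kind → ℤ
          rhs κ = ι (unsettled κ) * (+ 21 * k * D′) + orientation κ * (r * value S + p * w S)
          settled-rhs : kindOf S ≡ settled → 0ℤ ≤ rhs (kindOf S)
          settled-rhs eq = ≤-reflexive (sym (trans (cong rhs eq) (ring₂ (+ 21 * k * D′) (r * value S + p * w S))))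
            where
            ring₂ : ∀ x y → 0ℤ * x + 0ℤ * y ≡ 0ℤ
            ring₂ = solve-∀
          decide : Dec (C′.kindOf S ≡ settled) → Dec (kindOf S ≡ settled) → C′.mass S ≤ rhs (kindOf S)
          decide (no un′) _ = ≤-reflexive (cong₂ (λ κ v → ι (unsettled κ) * (+ 21 * k * D′) + orientation κ * v) (kind-same S small un′) (value′ S))
          decide (yes eq′) (yes eq) = ≤-trans (≤-reflexive (Linked.mass-closed D′ a′ G S eq′)) (settled-rhs eq)
          -- A member that has just settled has mass 0 now, and the mass it would have on its old
          -- side is nonnegative by `oriented≥0`.
          decide (yes eq′) (no un) = ≤-trans (≤-reflexive (Linked.mass-closed D′ a′ G S eq′))
            (subst (0ℤ ≤_) (cong₂ (λ u v → u * (+ 21 * k * D′) + orientation (kindOf S) * v) (sym (unsettled≡1 un)) (value′ S))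
              (subst (λ z → 0ℤ ≤ z + orientation (kindOf S) * C′.value S) (sym (*-identityˡ (+ 21 * k * D′)))
                (oriented≥0 S small un (<⇒≤ 0<D′) (highest-≤ S) (lowest-≤ S) (V′.value≤highest S) (V′.-value≤lowest S))))

      span-≤ : ∀ S → Linked.span D′ a′ G S ≤ span S
      span-≤ S = weight-mono S λ i → ι-mono (∨-mono (G S i) (floating-back i))

      inv′ : Linked.Invariant D′ a′ G
      inv′ = record
        { 0<D = 0<D′
        ; bounded = bounded′
        ; link⇒∈ = link⇒∈
        ; links≤ = links≤
        ; span≤ = λ S linked → ≤-trans (span-≤ S) (span≤ S linked)
        ; balanced = balanced′
        ; tame = tame′
        ; shared = shared′
        ; crowded = λ i fl′ → crowded i (floating-back i fl′)
        }

      -- Settled sets stay settled, and a set off by `420k` is held, so it can leave this bound only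
      -- by settling.
      pending-back : ∀ S → pending D′ a′ S ≡ true → pending D a S ≡ true
      pending-back S pend′ = [ (λ (_ , lt) → ready lt) , (λ h → ready (quiet (held S h) (links S <? + 4200 * k))) ]′ (open-cases S un)
        where
        un′ : C′.kindOf S ≢ settled
        un′ = proj₁ (pending-true (settled? (C′.kindOf S)) (C′.signed S <? + 420 * k * D′) pend′)
        lt′ : C′.signed S < + 420 * k * D′
        lt′ = proj₂ (pending-true (settled? (C′.kindOf S)) (C′.signed S <? + 420 * k * D′) pend′)
        un : kindOf S ≢ settled
        un = unsettled-back S un′
        ready : signed S < + 420 * k * D → pending D a S ≡ true
        ready = true-pending (settled? (kindOf S)) (signed S <? + 420 * k * D) un
        quiet : w S ≡ 0ℤ → Dec (links S < + 4200 * k) → signed S < + 420 * k * D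
        quiet _   (yes few) = ≤-<-trans (≤-reflexive (trans (cong (orientation (kindOf S) *_) (balanced S un few)) (*-zeroʳ (orientation (kindOf S))))) 0<420kD
        quiet w≡0 (no ¬few) = *-cancelˡ-<-nonNeg r {{nonNegative 0≤r}}
          (subst₂ _<_ (trans (signed′ S (full⇒small S (≮⇒≥ ¬few)) un′)
              (trans (cong (λ z → r * signed S + p * (orientation (kindOf S) * z)) w≡0) (ring r (signed S) p (orientation (kindOf S)))))
            (ring′ k r D) lt′)
          where
          ring : ∀ r s p o → r * s + p * (o * 0ℤ) ≡ r * s
          ring = solve-∀
          ring′ : ∀ k r D → + 420 * k * (r * D) ≡ r * (+ 420 * k * D)
          ring′ = solve-∀

      fewer-floats : ∀ i → y i ≢ 0ℤ → C′.floating i ≡ false → measure D′ a′ < measure D a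
      fewer-floats i y≢0 sunk = +-mono-<-≤ (∑-strict (λ j → ι-mono (floating-back j)) i
          (drop (C′.floating i) (floating i) sunk (floating? (floating i) refl))) (∑-mono λ S → ι-mono (pending-back S))
        where
        floating? : ∀ b → floating i ≡ b → b ≡ true
        floating? true  _  = refl
        floating? false eq = ⊥-elim (y≢0 (still i eq))

      -- The obstacle `h` is met with equality: its colour becomes `±D′`, or the oriented sum of its
      -- set, unless that set settles, becomes `420kD′`. In the latter cases the drift was nonzero,
      -- so the set was not held and had been pending.
      decrease : ∀ o → h ≡ o → measure D′ a′ < measure D a
      decrease (ceiling i) eq = fewer-floats i (λ y≡0 → <-irrefl (sym (trans r≡ y≡0)) 0<r)
          (cong isFloat (status-top (trans (cong₂ (λ u v → r * a i + u * v) (cong slack eq) (sym r≡)) (ring r (a i) D))))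
        where
        r≡ : r ≡ y i
        r≡ = cong speed eq
        ring : ∀ r a D → r * a + (D - a) * r ≡ r * D
        ring = solve-∀
      decrease (floor i) eq = fewer-floats i (λ y≡0 → <-irrefl (sym (trans r≡ (cong -_ y≡0))) 0<r)
          (cong isFloat (status-bot 0<D′ (trans (cong₂ (λ u v → r * a i + u * v) (cong slack eq) (trans (sym (neg-involutive (y i))) (cong -_ (sym r≡)))) (ring r (a i) D))))
        where
        r≡ : r ≡ - y i
        r≡ = cong speed eq
        ring : ∀ r a D → r * a + (a - - D) * - r ≡ - (r * D)
        ring = solve-∀
      decrease (load S) eq = +-mono-≤-< (∑-mono λ j → ι-mono (floating-back j)) (∑-strict (λ Q → ι-mono (pending-back Q)) S
          (drop (pending D′ a′ S) (pending D a S) (settles (pending D′ a′ S) refl)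
            (true-pending (settled? (kindOf S)) (signed S <? + 420 * k * D) un (proj₂ moving))))
        where
        r≡ : r ≡ drift S
        r≡ = cong speed eq
        un : kindOf S ≢ settled
        un settled≡ = <-irrefl (sym (trans r≡ (trans (cong (λ κ → orientation κ * w S) settled≡) (*-zeroˡ (w S))))) 0<r
        moving : + 4200 * k ≤ links S × signed S < + 420 * k * D
        moving = [ (λ x → x) , (λ hld → ⊥-elim (<-irrefl (sym (trans r≡ (stopped hld))) 0<r)) ]′ (open-cases S un)
          where
          stopped : isHeld (classOf S) ≡ true → drift S ≡ 0ℤ
          stopped hld = trans (cong (orientation (kindOf S) *_) (held S hld)) (*-zeroʳ (orientation (kindOf S)))
        settles : ∀ b → pending D′ a′ S ≡ b → b ≡ false
        settles false _ = refl
        settles true  pend′ = ⊥-elim (<-irrefl (trans (signed′ S (full⇒small S (proj₁ moving)) un′)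
            (trans (cong₂ (λ u v → r * signed S + u * v) (trans (cong slack eq) (cong (_* (+ 420 * k * D - signed S)) (unsettled≡1 un))) (sym r≡))
              (ring r (signed S) (+ 420 * k) D))) lt′)
          where
          un′ : C′.kindOf S ≢ settled
          un′ = proj₁ (pending-true (settled? (C′.kindOf S)) (C′.signed S <? + 420 * k * D′) pend′)
          lt′ : C′.signed S < + 420 * k * D′
          lt′ = proj₂ (pending-true (settled? (C′.kindOf S)) (C′.signed S <? + 420 * k * D′) pend′)
          ring : ∀ r s c D → r * s + 1ℤ * (c * D - s) * r ≡ c * (r * D)
          ring = solve-∀

    move : (∃[ i ] y i ≢ 0ℤ) → ∃[ D′ ] ∃[ a′ ] (Linked.Invariant D′ a′ G × measure D′ a′ < measure D a)
    move (i , y≢0) = go (first-hit slack speed 0≤slack (obstacles m n))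
      where
      go : All (λ o → speed o ≤ 0ℤ) (obstacles m n) ⊎ ∃ (FirstHit slack speed 0≤slack (obstacles m n)) →
        ∃[ D′ ] ∃[ a′ ] (Linked.Invariant D′ a′ G × measure D′ a′ < measure D a)
      -- A nonzero coordinate of `y` gives its ceiling or its floor positive speed, so there is an
      -- obstacle ahead.
      go (inj₁ slow) = ⊥-elim ([ (λ lt → <-irrefl refl (<-≤-trans lt (All.lookup slow (∈-obstacles (ceiling i)))))
                               , (λ lt → <-irrefl refl (<-≤-trans lt (All.lookup slow (∈-obstacles (floor i))))) ]′ (pos-or-neg y≢0))
      go (inj₂ (h , 0<h , best)) = H.D′ , H.a′ , H.inv′ , H.decrease h refl
        where module H = Hit h 0<h (λ o → All.lookup best (∈-obstacles o))

selected : ∀ {l} → (Fin l → Bool) → List (Fin l)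
selected {l} P = filter (λ j → P j Bool.≟ true) (allFin l)

solved : ∀ {l n} (P : Fin l → Bool) (row : Fin l → Fin n → ℤ) {y} →
  All (λ ρ → ρ · y ≡ 0ℤ) (map row (selected P)) → ∀ j → P j ≡ true → row j · y ≡ 0ℤ
solved P row zeros j Pj = All.lookup (All.map⁻ zeros) (∈-filter⁺ (λ j → P j Bool.≟ true) (∈-allFin j) Pj)

length-selected : ∀ {l} {B : Set} (P : Fin l → Bool) (row : Fin l → B) → + length (map row (selected P)) ≡ ∑ (λ j → ι (P j))
length-selected P row = trans (cong +_ (length-map row (selected P))) (length-filter-allFin P)

held⇒open : ∀ c → isHeld c ≡ true → isOpen c ≡ true
held⇒open big   _ = refl
held⇒open spare _ = refl
held⇒open tight _ = refl

isTop : Status → Bool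
isTop top = true
isTop _   = false

sign-hi : ∀ s → isFloat s ≡ false → sign (isTop s) ≡ hi s
sign-hi top _ = refl
sign-hi bot _ = refl

sign-lo : ∀ s → isFloat s ≡ false → -1ℤ * sign (isTop s) ≡ lo s
sign-lo top _ = refl
sign-lo bot _ = refl

settled-bounds : ∀ {T u v} → KindView T u v settled → u ≤ T × v ≤ T
settled-bounds (settled u≤ v≤) = u≤ , v≤

-- Without floating elements the deficit of an unsettled set would be all of `d`, forcing
-- `2d ≤ 421k`.
end-arith : ∀ D d k f w → 0ℤ < D → 1ℤ ≤ k → + 466201 * k ≤ d → f ≡ 0ℤ → + 2 * D * (d - f) ≤ w + k * D → ¬ (w ≤ + 420 * k * D)
end-arith D d k f w 0<D 1≤k k≤d refl def tame = <-irrefl refl (<-≤-trans 0<D D≤0)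
  where
  ring : ∀ D d k w → (w + k * D - + 2 * D * (d - 0ℤ)) + (+ 420 * k * D - w) + + 2 * D * (d - + 466201 * k) + + 931981 * D * (k - 1ℤ) + + 931980 * D ≡ 0ℤ - D
  ring = solve-∀
  D≤0 : D ≤ 0ℤ
  D≤0 = by (gap def ⊕ gap tame ⊕ nat 2 ⊗ <⇒≤ 0<D ⊗ gap k≤d ⊕ nat 931981 ⊗ <⇒≤ 0<D ⊗ gap 1≤k ⊕ nat 931980 ⊗ <⇒≤ 0<D) (ring D d k w)

-- Running the process

module Discrepancy (m n : ℕ) (A : Fin m → Fin n → Bool) (d k : ℤ)
  (1≤k : 1ℤ ≤ k) (k≤d : + 466201 * k ≤ d) (degree≤ : ∀ i → ∑ (λ S → ι (A S i)) ≤ d) where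

  open Bundles m n A d k 1≤k
  open Measure m n A d k

  module Advance (D : ℤ) (a : Fin n → ℤ) (G : Fin m → Fin n → Bool) (inv : Linked.Invariant D a G) where

    open Linked D a G
    open Invariant inv
    open Counting m n A d k 1≤k k≤d degree≤ D a G using (centre; few-constraints)
    open Move m n A d k 1≤k k≤d D a G inv using (module Along)

    Next : Set
    Next = ∃[ D′ ] ∃[ a′ ] (Linked.Invariant D′ a′ G × measure D′ a′ < measure D a)

    incidence : Fin m → Fin n → ℤ
    incidence S i = ι (A S i)

    -- Sets enter with their orientation, so that one equation controls the total mass over the
    -- star.
    star : Fin n → Fin n → ℤ
    star i j = ∑ λ S → ι (G S i) * (orientation (kindOf S) * ι (A S j))

    star-dot : ∀ i y → star i · y ≡ ∑ (λ S → ι (G S i) * (orientation (kindOf S) * weight S y))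
    star-dot i y = begin
      ∑ (λ j → ∑ (λ S → ι (G S i) * (o S * ι (A S j))) * y j)
        ≡⟨ ∑-cong (λ j → trans (*-comm (star i j) (y j)) (sym (∑-* (y j) (λ S → ι (G S i) * (o S * ι (A S j)))))) ⟩
      ∑ (λ j → ∑ (λ S → y j * (ι (G S i) * (o S * ι (A S j)))))
        ≡⟨ ∑-swap (λ j S → y j * (ι (G S i) * (o S * ι (A S j)))) ⟩
      ∑ (λ S → ∑ (λ j → y j * (ι (G S i) * (o S * ι (A S j)))))
        ≡⟨ ∑-cong (λ S → trans (∑-cong λ j → ring (y j) (ι (G S i)) (o S) (ι (A S j)))
             (trans (∑-* (ι (G S i) * o S) (λ j → ι (A S j) * y j)) (*-assoc (ι (G S i)) (o S) (weight S y)))) ⟩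
      ∑ (λ S → ι (G S i) * (o S * weight S y)) ∎
      where
      open ≡-Reasoning
      o : Fin m → ℤ
      o S = orientation (kindOf S)
      ring : ∀ y g o x → y * (g * (o * x)) ≡ g * o * (x * y)
      ring = solve-∀

    -- Here the sums of all unsettled sets can be kept, and the star equations hold because every
    -- single drift is 0.
    hold-all : ∑ (λ S → ι (isOpen (classOf S))) < ∑ (λ i → ι (floating i)) → Next
    hold-all few = go (kernel-vector floating (map incidence (selected (λ S → isOpen (classOf S))))
        (≤-<-trans (≤-reflexive (length-selected (λ S → isOpen (classOf S)) incidence)) few))
      where
      go : ∃[ y ] ((∃[ i ] y i ≢ 0ℤ) × (∀ i → floating i ≡ false → y i ≡ 0ℤ) × All (λ ρ → ρ · y ≡ 0ℤ) (map incidence (selected (λ S → isOpen (classOf S))))) → Next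
      go (y , nz , still , zeros) = Along.move y still (λ S h → rigid S (held⇒open (classOf S) h)) centred nz
        where
        rigid : ∀ S → isOpen (classOf S) ≡ true → weight S y ≡ 0ℤ
        rigid = solved (λ S → isOpen (classOf S)) incidence zeros
        still-drift : ∀ S → orientation (kindOf S) * weight S y ≡ 0ℤ
        still-drift S = cases (classOf S) refl (classView S)
          where
          rigid′ : isOpen (classOf S) ≡ true → orientation (kindOf S) * weight S y ≡ 0ℤ
          rigid′ op = trans (cong (orientation (kindOf S) *_) (rigid S op)) (*-zeroʳ (orientation (kindOf S)))
          cases : ∀ c → classOf S ≡ c → ClassView S c → orientation (kindOf S) * weight S y ≡ 0ℤ
          cases _ _  (closed eq)   = trans (cong (λ κ → orientation κ * weight S y) eq) (*-zeroˡ (weight S y))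
          cases _ eq (big _ _ _)   = rigid′ (cong isOpen eq)
          cases _ eq (spare _ _ _) = rigid′ (cong isOpen eq)
          cases _ eq (loose _ _ _) = rigid′ (cong isOpen eq)
          cases _ eq (tight _ _ _) = rigid′ (cong isOpen eq)
        centred : ∀ i → floating i ≡ true → ∑ (λ S → ι (G S i) * (orientation (kindOf S) * weight S y)) ≡ 0ℤ
        centred i _ = ∑-zero λ S → trans (cong (ι (G S i) *_) (still-drift S)) (*-zeroʳ (ι (G S i)))

    hold-some : Saturated → 0ℤ < ∑ (λ i → ι (floating i)) → ∑ (λ i → ι (floating i)) ≤ ∑ (λ S → ι (isOpen (classOf S))) → Next
    hold-some saturated 0<U U≤H = go (kernel-vector floating rows
        (≤-<-trans (≤-reflexive (trans (cong +_ (length-++ stars)) (trans (pos-+ (length stars) (length sets))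
            (cong₂ _+_ (length-selected centre star) (length-selected (λ S → isHeld (classOf S)) incidence)))))
          (few-constraints inv saturated 0<U U≤H)))
      where
      stars sets rows : List (Fin n → ℤ)
      stars = map star (selected centre)
      sets  = map incidence (selected (λ S → isHeld (classOf S)))
      rows  = stars ++ sets

      go : ∃[ y ] ((∃[ i ] y i ≢ 0ℤ) × (∀ i → floating i ≡ false → y i ≡ 0ℤ) × All (λ ρ → ρ · y ≡ 0ℤ) rows) → Next
      go (y , nz , still , zeros) = Along.move y still (solved (λ S → isHeld (classOf S)) incidence (All.++⁻ʳ stars zeros)) centred nz
        where
        on-centre : ∀ i → centre i ≡ true → ∑ (λ S → ι (G S i) * (orientation (kindOf S) * weight S y)) ≡ 0ℤ
        on-centre i c = trans (sym (star-dot i y)) (solved centre star (All.++⁻ˡ stars zeros) i c)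
        centre-true : ∀ i → floating i ≡ true → (p : Dec (+ 46200 * k ≤ members i)) → + 46200 * k ≤ members i → floating i ∧ does p ≡ true
        centre-true i fl (yes _) _ = cong (_∧ true) fl
        centre-true i fl (no ¬p) p = ⊥-elim (¬p p)
        centred : ∀ i → floating i ≡ true → ∑ (λ S → ι (G S i) * (orientation (kindOf S) * weight S y)) ≡ 0ℤ
        -- By `crowded` a floating element has either no members or a star of full size, whose
        -- equation is among the rows.
        centred i fl = [ empty , (λ many → on-centre i (centre-true i fl (+ 46200 * k ≤? members i) many)) ]′ (crowded i fl)
          where
          empty : members i ≡ 0ℤ → ∑ (λ S → ι (G S i) * (orientation (kindOf S) * weight S y)) ≡ 0ℤ
          empty none = ∑-zero λ S → trans (cong (_* (orientation (kindOf S) * weight S y))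
              (≤-antisym (≤-trans (∑-member (λ Q → 0≤ι (G Q i)) S) (≤-reflexive none)) (0≤ι (G S i))))
            (*-zeroˡ (orientation (kindOf S) * weight S y))

    advance : Saturated → 0ℤ < ∑ (λ i → ι (floating i)) → Next
    advance saturated 0<U = decide (∑ (λ i → ι (floating i)) ≤? ∑ (λ S → ι (isOpen (classOf S))))
      where
      decide : Dec (∑ (λ i → ι (floating i)) ≤ ∑ (λ S → ι (isOpen (classOf S)))) → Next
      decide (yes U≤H) = hold-some saturated 0<U U≤H
      decide (no  U≰H) = hold-all (≰⇒> U≰H)

  Finished : Set
  Finished = ∃[ D ] ∃[ a ] ∃[ G ] (Linked.Invariant D a G × (∀ i → Colour.floating D a i ≡ false))

  0≤measure : ∀ D a → 0ℤ ≤ measure D a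
  0≤measure D a = ∑-nonneg (λ i → 0≤ι (Colour.floating D a i)) ⊕ ∑-nonneg (λ S → 0≤ι (pending D a S))

  -- Stars are completed before each move. This leaves the colouring and hence `measure` unchanged,
  -- so `fuel` pays for moves only.
  run : ∀ fuel D a G → Linked.Invariant D a G → measure D a ≤ + fuel → Finished
  run fuel D a G inv enough = decide (0ℤ <? ∑ (λ i → ι (Colour.floating D a i))) fuel enough
    where
    none : ∑ (λ i → ι (Colour.floating D a i)) ≤ 0ℤ → ∀ i b → Colour.floating D a i ≡ b → b ≡ false
    none _  i false _  = refl
    none ≤0 i true  eq = ⊥-elim (<-irrefl refl (<-≤-trans (+<+ (ℕ.s≤s ℕ.z≤n))
      (≤-trans (≤-reflexive (cong ι (sym eq))) (≤-trans (∑-member (λ j → 0≤ι (Colour.floating D a j)) i) ≤0))))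

    bound : ℤ
    bound = ∑ {m} (λ _ → + 4200 * k)

    prepared : ∃[ G′ ] (Linked.Invariant D a G′ × Linked.Saturated D a G′)
    prepared = Saturation.saturate m n A d k 1≤k D a ∣ bound ∣ G inv
      (≤-trans (≤-reflexive (sym (0≤i⇒+∣i∣≡i (∑-nonneg {m} λ _ → nat 4200 ⊗ 0≤k))))
        (≤-trans (≤-reflexive (sym (+-identityʳ (+ ∣ bound ∣)))) (+-monoʳ-≤ (+ ∣ bound ∣) (∑-nonneg λ i → ∑-nonneg λ S → 0≤ι (G S i)))))

    decide : Dec (0ℤ < ∑ (λ i → ι (Colour.floating D a i))) → ∀ fuel → measure D a ≤ + fuel → Finished
    decide (no  U≯0) _ _ = D , a , G , inv , λ i → none (≮⇒≥ U≯0) i (Colour.floating D a i) refl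
    decide (yes 0<U) fuel enough = continue prepared fuel enough
      where
      continue : ∃[ G′ ] (Linked.Invariant D a G′ × Linked.Saturated D a G′) → ∀ fuel → measure D a ≤ + fuel → Finished
      continue (G′ , inv′ , saturated) fuel enough = next (Advance.advance D a G′ inv′ saturated 0<U) fuel enough
        where
        next : ∃[ D″ ] ∃[ a″ ] (Linked.Invariant D″ a″ G′ × measure D″ a″ < measure D a) → ∀ fuel → measure D a ≤ + fuel → Finished
        next (D″ , a″ , inv″ , less) ℕ.zero    enough = ⊥-elim (<-irrefl refl (<-≤-trans (≤-<-trans (0≤measure D″ a″) less) enough))
        next (D″ , a″ , inv″ , less) (ℕ.suc f) enough = run f D″ a″ G′ inv″ (i<j⇒i≤pred[j] (<-≤-trans less enough))

  start : Linked.Invariant 1ℤ (λ _ → 0ℤ) (λ _ _ → false)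
  start = record
    { 0<D = +<+ (ℕ.s≤s ℕ.z≤n)
    ; bounded = λ i → -≤+ , nat 1
    ; link⇒∈ = λ S i ()
    ; links≤ = λ S → ≤-trans (≤-reflexive (∑-zero {n} λ _ → refl)) (nat 4200 ⊗ 0≤k)
    ; span≤ = λ S linked → ⊥-elim (<-irrefl (sym (∑-zero {n} λ _ → refl)) linked)
    ; balanced = λ S _ _ → zero-value S
    ; tame = λ S _ → ≤-trans (≤-reflexive (trans (cong (orientation (kindOf S) *_) (zero-value S)) (*-zeroʳ (orientation (kindOf S))))) (nat 420 ⊗ 0≤k ⊗ nat 1)
    ; shared = λ i _ → ≤-trans (≤-reflexive (∑-zero {m} λ S → *-zeroˡ (mass S))) (nat 21 ⊗ 0≤k ⊗ nat 1 ⊗ ∑-nonneg {m} (λ _ → nat 0))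
    ; crowded = λ i _ → inj₁ (∑-zero {m} λ _ → refl)
    }
    where
    open Colour 1ℤ (λ _ → 0ℤ)
    zero-value : ∀ S → value S ≡ 0ℤ
    zero-value S = ∑-zero λ i → *-zeroʳ (ι (A S i))

  finished : Finished
  finished = run ∣ measure 1ℤ (λ _ → 0ℤ) ∣ 1ℤ (λ _ → 0ℤ) (λ _ _ → false) start
    (≤-reflexive (sym (0≤i⇒+∣i∣≡i (0≤measure 1ℤ (λ _ → 0ℤ)))))

  low-discrepancy : ∃[ χ ] (∀ S → weight S (λ i → sign (χ i)) ≤ + 2 * d - k × -1ℤ * weight S (λ i → sign (χ i)) ≤ + 2 * d - k)
  low-discrepancy = conclude finished
    where
    conclude : Finished → ∃[ χ ] (∀ S → weight S (λ i → sign (χ i)) ≤ + 2 * d - k × -1ℤ * weight S (λ i → sign (χ i)) ≤ + 2 * d - k)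
    conclude (D , a , G , inv , sunk) = (λ i → isTop (st i)) , λ S → within S (settled-bounds
        (subst (KindView (+ 2 * d - k) (highest S) (lowest S)) (calm S) (kind-view (+ 2 * d - k) (highest S) (lowest S))))
      where
      open Linked D a G
      open Invariant inv
      open Consequences inv

      no-floats : ∀ S → floats S ≡ 0ℤ
      no-floats S = ∑-zero λ i → trans (cong (λ b → ι (A S i) * ι b) (sunk i)) (*-zeroʳ (ι (A S i)))

      calm : ∀ S → kindOf S ≡ settled
      calm S = decide (settled? (kindOf S))
        where
        decide : Dec (kindOf S ≡ settled) → kindOf S ≡ settled
        decide (yes eq) = eq
        decide (no  un) = ⊥-elim (end-arith D d k (floats S) (signed S) 0<D 1≤k k≤d (no-floats S) (deficit S un) (tame S un))

      within : ∀ S → highest S ≤ + 2 * d - k × lowest S ≤ + 2 * d - k →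
        weight S (λ i → sign (isTop (st i))) ≤ + 2 * d - k × -1ℤ * weight S (λ i → sign (isTop (st i))) ≤ + 2 * d - k
      within S (h≤ , l≤) =
        ≤-trans (≤-reflexive (∑-cong λ i → cong (ι (A S i) *_) (sign-hi (st i) (sunk i)))) h≤ ,
        ≤-trans (≤-reflexive (trans (sym (weight-scale S -1ℤ (λ i → sign (isTop (st i))))) (∑-cong λ i → cong (ι (A S i) *_) (sign-lo (st i) (sunk i))))) l≤

-- From indexed set systems to lists of subsets

mutual
  -- A leading `false` makes `χsum` unfold to its local function on the tail. Abstracting the size,
  -- the colouring, the whole set and the index vector turns its arguments into distinct variables,
  -- from which unification can identify it.
  χsum-shifted : ∀ {m} (χ : Coloring (ℕ.suc m)) (s : Subset m) →
    χsum χ (false ∷ s) ≡ ∑ (λ j → ι (lookup s j) * sign (χ (lookup (tabulate ((λ i → i) ∘ suc)) j)))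
  χsum-shifted {m} χ s with ℕ.suc m | χ | false ∷ s | tabulate {n = m} ((λ i → i) ∘ suc)
  ... | _ | χ′ | S | is = χsum-along χ′ S s is

  -- The left-hand side is the local function of χsum: it cannot be named here, but χsum-shifted determines it.
  χsum-along : ∀ {n m} (χ : Coloring n) (S : Subset n) (s : Subset m) (is : Vec (Fin n) m) →
    _ ≡ ∑ (λ j → ι (lookup s j) * sign (χ (lookup is j)))
  χsum-along χ S []          []       = sym (∑-zero λ ())
  χsum-along χ S (true  ∷ s) (i ∷ is) = trans (cong₂ _+_ (sym (*-identityˡ (sign (χ i)))) (χsum-along χ S s is))
    (sym (∑-suc (λ j → ι (lookup (true ∷ s) j) * sign (χ (lookup (i ∷ is) j)))))
  χsum-along χ S (false ∷ s) (i ∷ is) = trans (χsum-along χ S s is)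
    (trans (sym (+-identityˡ (∑ (λ j → ι (lookup s j) * sign (χ (lookup is j))))))
      (trans (cong (_+ ∑ (λ j → ι (lookup s j) * sign (χ (lookup is j)))) (sym (*-zeroˡ (sign (χ i)))))
        (sym (∑-suc (λ j → ι (lookup (false ∷ s) j) * sign (χ (lookup (i ∷ is) j)))))))

χsum≡∑ : ∀ {n} (χ : Coloring n) S → χsum χ S ≡ ∑ (λ i → ι (lookup S i) * sign (χ i))
χsum≡∑ χ S = trans (χsum-along χ S S (tabulate λ i → i)) (∑-cong λ i → cong (λ j → ι (lookup S i) * sign (χ j)) (lookup∘tabulate (λ i → i) i))

degree≡∑ : ∀ {n} (𝓕 : List (Subset n)) x → ∑ (λ S → ι (lookup (List.lookup 𝓕 S) x)) ≡ + degree 𝓕 x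
degree≡∑ []      x = ∑-zero λ ()
degree≡∑ (S ∷ 𝓕) x = trans (∑-suc (λ Q → ι (lookup (List.lookup (S ∷ 𝓕) Q) x))) (head (x ∈? S))
  where
  head : Dec (x Subset.∈ S) → ι (lookup S x) + ∑ (λ Q → ι (lookup (List.lookup 𝓕 Q) x)) ≡ + degree (S ∷ 𝓕) x
  head (yes x∈S) = trans (cong₂ _+_ (cong ι ([]=⇒lookup x∈S)) (degree≡∑ 𝓕 x)) (cong (λ l → + length l) (sym (filter-accept (x ∈?_) x∈S)))
  head (no  x∉S) = trans (cong₂ _+_ (cong ι (lookup-false (lookup S x) refl)) (degree≡∑ 𝓕 x))
      (trans (+-identityˡ (+ degree 𝓕 x)) (cong (λ l → + length l) (sym (filter-reject (x ∈?_) x∉S))))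
    where
    lookup-false : ∀ b → lookup S x ≡ b → lookup S x ≡ false
    lookup-false false eq = eq
    lookup-false true  eq = ⊥-elim (x∉S (lookup⇒[]= x S eq))

-- Growth of the iterated logarithm

1+n≤2^n : ∀ n → ℕ.suc n ℕ.≤ 2 ℕ.^ n
1+n≤2^n ℕ.zero    = ℕ.≤-refl
1+n≤2^n (ℕ.suc n) = ℕ.≤-trans (ℕ.+-mono-≤ (ℕ.s≤s ℕ.z≤n) (1+n≤2^n n))
  (ℕ.+-mono-≤ (ℕ.≤-trans (ℕ.s≤s ℕ.z≤n) (1+n≤2^n n)) (ℕ.≤-reflexive (sym (ℕ.+-identityʳ (2 ℕ.^ n)))))

⌈log₂⌉-< : ∀ n → 1 ℕ.≤ n → ⌈log₂ n ⌉ ℕ.< n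
⌈log₂⌉-< (ℕ.suc n) _ = ℕ.s≤s (ℕ.≤-trans (⌈log₂⌉-mono-≤ (1+n≤2^n n)) (ℕ.≤-reflexive (⌈log₂2^n⌉≡n n)))

-- While the iterated logarithm exceeds 1, each further step lowers it by at least one. This crude
-- bound suffices to compare `466201 t` with `d`.
logStar≤ : ∀ {d t} → IsLogStar d t → t ℕ.≤ 1 ℕ.+ ⌈log₂ d ⌉
logStar≤ {d} {ℕ.zero}  _         = ℕ.z≤n
logStar≤ {d} {ℕ.suc t} (_ , large) = ℕ.s≤s (ℕ.≤-trans (ℕ.m≤n+m t (iterLog (ℕ.suc t) d)) (descend t ℕ.≤-refl))
  where
  descend : ∀ j → j ℕ.≤ t → iterLog (ℕ.suc j) d ℕ.+ j ℕ.≤ ⌈log₂ d ⌉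
  descend ℕ.zero    _   = ℕ.≤-reflexive (ℕ.+-identityʳ ⌈log₂ d ⌉)
  descend (ℕ.suc j) j<t = ℕ.≤-trans (ℕ.≤-reflexive (ℕ.+-suc (iterLog (ℕ.suc (ℕ.suc j)) d) j))
    (ℕ.≤-trans (ℕ.+-monoˡ-≤ j (⌈log₂⌉-< (iterLog (ℕ.suc j) d) (ℕ.<⇒≤ (large (ℕ.suc j) (ℕ.s≤s j<t))))) (descend j (ℕ.<⇒≤ j<t)))

-- Increasing the exponent by one doubles the right-hand side and at most doubles the left-hand
-- side.
exponential-wins : ∀ c e → c ℕ.* (2 ℕ.+ e) ℕ.≤ 2 ℕ.^ e → ∀ j → c ℕ.* (2 ℕ.+ (e ℕ.+ j)) ℕ.≤ 2 ℕ.^ (e ℕ.+ j)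
exponential-wins c e base ℕ.zero    = subst (λ z → c ℕ.* (2 ℕ.+ z) ℕ.≤ 2 ℕ.^ z) (sym (ℕ.+-identityʳ e)) base
exponential-wins c e base (ℕ.suc j) = subst (λ z → c ℕ.* (2 ℕ.+ z) ℕ.≤ 2 ℕ.^ z) (sym (ℕ.+-suc e j))
  (double (2 ℕ.+ (e ℕ.+ j)) (2 ℕ.^ (e ℕ.+ j)) (ℕ.s≤s ℕ.z≤n) (exponential-wins c e base j))
  where
  double : ∀ n p → 1 ℕ.≤ n → c ℕ.* n ℕ.≤ p → c ℕ.* ℕ.suc n ℕ.≤ 2 ℕ.* p
  double n p 1≤n cn≤p = ℕ.≤-trans (ℕ.*-monoʳ-≤ c (ℕ.+-mono-≤ 1≤n (ℕ.≤-reflexive (sym (ℕ.+-identityʳ n)))))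
    (ℕ.≤-trans (ℕ.≤-reflexive (trans (sym (ℕ.*-assoc c 2 n)) (trans (cong (ℕ._* n) (ℕ.*-comm c 2)) (ℕ.*-assoc 2 c n)))) (ℕ.*-monoʳ-≤ 2 cn≤p))

-- If `⌈log₂ d⌉ = e + 1 + j`, then `d > 2^(e + j)`, and `exponential-wins` at `j` has
-- `c (1 + ⌈log₂ d⌉)` on its left.
log-small : ∀ c e → c ℕ.* (2 ℕ.+ e) ℕ.≤ 2 ℕ.^ e → ∀ d → 2 ℕ.^ ℕ.suc e ℕ.≤ d → c ℕ.* (1 ℕ.+ ⌈log₂ d ⌉) ℕ.≤ d
log-small c e base d large = go (⌈log₂ d ⌉ ℕ.∸ ℕ.suc e)
    (sym (ℕ.m+[n∸m]≡n (ℕ.≤-trans (ℕ.≤-reflexive (sym (⌈log₂2^n⌉≡n (ℕ.suc e)))) (⌈log₂⌉-mono-≤ large))))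
  where
  go : ∀ j → ⌈log₂ d ⌉ ≡ ℕ.suc e ℕ.+ j → c ℕ.* (1 ℕ.+ ⌈log₂ d ⌉) ℕ.≤ d
  go j eq = subst (λ ℓ → c ℕ.* (1 ℕ.+ ℓ) ℕ.≤ d) (sym eq) (ℕ.≤-trans (exponential-wins c e base j) (ℕ.<⇒≤ (ℕ.≰⇒> small)))
    where
    small : ¬ (d ℕ.≤ 2 ℕ.^ (e ℕ.+ j))
    small d≤ = ℕ.<-irrefl refl (ℕ.≤-trans (ℕ.≤-reflexive (sym eq)) (ℕ.≤-trans (⌈log₂⌉-mono-≤ d≤) (ℕ.≤-reflexive (⌈log₂2^n⌉≡n (e ℕ.+ j)))))

∣∣-bound : ∀ {x T} → x ≤ T → -1ℤ * x ≤ T → + ∣ x ∣ ≤ T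
∣∣-bound {+ n}      x≤ _  = x≤
∣∣-bound { -[1+ n ]} _ -x≤ = ≤-trans (≤-reflexive (sym (-1*i≡-i -[1+ n ]))) -x≤

low-discrepancy-family : ∀ n (𝓕 : List (Subset n)) d t → 1 ℕ.≤ t → + 466201 * + t ≤ + d → MaxDegree≤ 𝓕 d →
  ∃[ χ ] ((S : Subset n) → S ∈ 𝓕 → + ∣ χsum χ S ∣ ≤ + 2 * + d - + t)
low-discrepancy-family n 𝓕 d t 1≤t t≤d degree≤ = transfer
    (Discrepancy.low-discrepancy (length 𝓕) n (λ S → lookup (List.lookup 𝓕 S)) (+ d) (+ t) (+≤+ 1≤t) t≤d
      (λ i → ≤-trans (≤-reflexive (degree≡∑ 𝓕 i)) (+≤+ (degree≤ i))))
  where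
  open System (length 𝓕) n (λ S → lookup (List.lookup 𝓕 S)) (+ d) (+ t) using (weight)
  transfer : ∃[ χ ] (∀ S → weight S (λ i → sign (χ i)) ≤ + 2 * + d - + t × -1ℤ * weight S (λ i → sign (χ i)) ≤ + 2 * + d - + t) →
    ∃[ χ ] ((S : Subset n) → S ∈ 𝓕 → + ∣ χsum χ S ∣ ≤ + 2 * + d - + t)
  transfer (χ , good) = χ , λ S S∈𝓕 → subst (λ x → + ∣ x ∣ ≤ + 2 * + d - + t) (sym (χsum≡∑ χ S))
    (subst (λ Q → + ∣ ∑ (λ i → ι (lookup Q i) * sign (χ i)) ∣ ≤ + 2 * + d - + t) (sym (lookup-index S∈𝓕))
      (∣∣-bound (proj₁ (good (index S∈𝓕))) (proj₂ (good (index S∈𝓕)))))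

-- The process is run with `k = log* d` and requires `1 ≤ k`.
logStar-positive : ∀ {d t} → 2 ℕ.≤ d → IsLogStar d t → 1 ℕ.≤ t
logStar-positive {t = ℕ.zero}  2≤d (d≤1 , _) = ⊥-elim (ℕ.<-irrefl refl (ℕ.≤-trans 2≤d d≤1))
logStar-positive {t = ℕ.suc t} _   _         = ℕ.s≤s ℕ.z≤n

logStar-small : ∀ c e → c ℕ.* (2 ℕ.+ e) ℕ.≤ 2 ℕ.^ e → ∀ d t → 2 ℕ.^ ℕ.suc e ℕ.≤ d → IsLogStar d t → + c * + t ≤ + d
logStar-small c e base d t large logStar = ≤-trans (≤-reflexive (sym (pos-* c t)))
  (+≤+ (ℕ.≤-trans (ℕ.*-monoʳ-≤ c (logStar≤ logStar)) (log-small c e base d large)))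

mainTheorem1 : ∃[ d₀ ] ((d : ℕ) → d ≥ d₀ → (t : ℕ) → IsLogStar d t →
    (n : ℕ) → (𝓕 : List (Subset n)) → Unique 𝓕 → MaxDegree≤ 𝓕 d →
    ∃[ χ ] ((S : Subset n) → S ∈ 𝓕 →
    + ∣ χsum χ S ∣ ≤ (+ 2 Data.Integer.* + d) - + t))
mainTheorem1 = 2 ℕ.^ 30 , λ d large t logStar n 𝓕 _ degree≤ →
  low-discrepancy-family n 𝓕 d t (logStar-positive (ℕ.≤-trans (ℕ.≤ᵇ⇒≤ 2 (2 ℕ.^ 30) _) large) logStar) 
    -- The exponent 29 yields the threshold `2 ^ 30`; the inequality `466201 · 31 ≤ 2 ^ 29` is
    -- checked by evaluation.
    (logStar-small 466201 29 (ℕ.≤ᵇ⇒≤ (466201 ℕ.* 31) (2 ℕ.^ 29) _) d t large logStar) degree≤
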